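{- There is a function $f$ such that the following holds. Let $\varphi$ be an unsatisfiable CNF with $n$ variables such that there are at most $p$ clauses of $\varphi$ whose removal from $\varphi$ results in a CNF of primal treewidth at most $k$. Then there is a regular resolution refutation of $\varphi$ having at most $f(k,p)\cdot n^2$ nodes (the paper counts these as "clauses" of the proof).
   Context: A CNF is a set of clauses, a clause is a set of literals. The primal graph of a CNF has its variables as vertices, two variables being adjacent if they occur together in some clause; primal treewidth is the treewidth of this graph. For a set $S$ of literals (never containing a literal and its negation), $S$ falsifies a clause $C$ if $\neg \ell\in S$ for every literal $\ell\in C$. A regular resolution (RR) refutation of an unsatisfiable CNF $\varphi$ is a directed acyclic graph $H$ with a single source in which every non-sink node has exactly two out-neighbours; every non-sink node is labelled by a variable of $\varphi$ so that no variable labels two distinct nodes of the same directed path; for a non-sink node labelled $x$, one outgoing edge is labelled $x$ and the other $\neg x$; for a directed path $P$, $A(P)$ denotes the set of literals labelling its edges; each sink $u$ is labelled by a clause $C$ of $\varphi$ such that for every source-to-$u$ path $P$, $A(P)$ falsifies $C$. The size of the refutation is its number of nodes.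
   Formalization: The number n of variables is assumed to be at least 1: for n = 0 the CNF consisting of the empty clause is unsatisfiable, but its refutation needs one node while the bound f(k,p)·n² is 0. -}

module Defs where

open import Data.Nat using (ℕ; zero; suc; _≤_; _<_)
open import Data.Bool using (Bool; true; false; not)
import Data.Bool.Properties as BoolP
open import Data.Fin using (Fin; zero; suc; toℕ)
open import Data.Fin.Subset using (Subset; _∈_; ∣_∣)
open import Data.Product using (Σ; ∃; ∃-syntax; _×_; _,_; proj₁; proj₂)
open import Data.Sum using (_⊎_)
open import Data.List using (List; []; _∷_; filter; length)
import Data.List.Membership.Propositional as LM
import Data.List.Membership.DecPropositional as LMD
import Data.Vec.Properties as VecP
import Data.Product.Properties as ProdP
open import Relation.Nullary using (¬_; ¬?)
open import Relation.Binary.PropositionalEquality using (_≡_; _≢_)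
open import Relation.Binary.Definitions using (DecidableEquality)

-- A literal: a variable together with a polarity (true = positive x, false = ¬x).
Literal : ℕ → Set
Literal n = Fin n × Bool

negLit : ∀ {n} → Literal n → Literal n
negLit (x , b) = (x , not b)

-- A clause is a set of literals, represented canonically by
-- (set of variables occurring positively , set of variables occurring negatively).
Clause : ℕ → Set
Clause n = Subset n × Subset n

_∈C_ : ∀ {n} → Literal n → Clause n → Set
(x , true)  ∈C (P , N) = x ∈ P
(x , false) ∈C (P , N) = x ∈ N

CNF : ℕ → Set
CNF n = List (Clause n)

clause-≟ : ∀ {n} → DecidableEquality (Clause n)
clause-≟ = ProdP.≡-dec (VecP.≡-dec BoolP._≟_) (VecP.≡-dec BoolP._≟_)

remove : ∀ {n} → List (Clause n) → CNF n → CNF n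
remove D φ = filter (λ C → ¬? (C ∈? D)) φ
  where open LMD clause-≟ using (_∈?_)

Assignment : ℕ → Set
Assignment n = Fin n → Bool

SatisfiesClause : ∀ {n} → Assignment n → Clause n → Set
SatisfiesClause α C = ∃[ ℓ ] (ℓ ∈C C × α (proj₁ ℓ) ≡ proj₂ ℓ)

Unsatisfiable : ∀ {n} → CNF n → Set
Unsatisfiable {n} φ = ¬ (Σ (Assignment n) λ α → ∀ C → C LM.∈ φ → SatisfiesClause α C)

Falsifies : ∀ {n} → List (Literal n) → Clause n → Set
Falsifies S C = ∀ ℓ → ℓ ∈C C → negLit ℓ LM.∈ S

Graph : ℕ → Set₁
Graph n = Fin n → Fin n → Set

occurs : ∀ {n} → Fin n → Clause n → Set
occurs x (P , N) = x ∈ P ⊎ x ∈ N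

PrimalGraph : ∀ {n} → CNF n → Graph n
PrimalGraph φ x y = x ≢ y × ∃[ C ] (C LM.∈ φ × occurs x C × occurs y C)

-- A tree on the nodes Fin (suc m), given by parent pointers:
-- node (suc i) has parent (parent i), whose index is ≤ i.  (Every finite
-- tree admits such a labelling, e.g. a BFS order from a root.)
TreeAdj : ∀ {m} → (Fin m → Fin (suc m)) → Fin (suc m) → Fin (suc m) → Set
TreeAdj {m} parent a b =
  ∃[ i ] ((a ≡ suc i × b ≡ parent i) ⊎ (a ≡ parent i × b ≡ suc i))

data WalkIn {m} (parent : Fin m → Fin (suc m)) (S : Fin (suc m) → Set)
       : Fin (suc m) → Fin (suc m) → Set where
  here : ∀ {a} → WalkIn parent S a a
  step : ∀ {a b c} → TreeAdj parent a b → S b → WalkIn parent S b c →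
         WalkIn parent S a c

record TreeDecomposition {n} (G : Graph n) (k : ℕ) : Set₁ where
  field
    m         : ℕ
    parent    : Fin m → Fin (suc m)
    parent≤   : ∀ i → toℕ (parent i) ≤ toℕ i
    bag       : Fin (suc m) → Subset n
    width     : ∀ t → ∣ bag t ∣ ≤ suc k
    vcover    : ∀ x → ∃[ t ] (x ∈ bag t)
    ecover    : ∀ x y → G x y → ∃[ t ] (x ∈ bag t × y ∈ bag t)
    connected : ∀ x t t′ → x ∈ bag t → x ∈ bag t′ →
                WalkIn parent (λ u → x ∈ bag u) t t′

TreewidthAtMost : ∀ {n} → Graph n → ℕ → Set₁
TreewidthAtMost G k = TreeDecomposition G k

DeletionTW : ∀ {n} → CNF n → ℕ → ℕ → Set₁
DeletionTW {n} φ k p =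
  Σ (List (Clause n)) λ D → length D ≤ p × TreewidthAtMost (PrimalGraph (remove D φ)) k

data NodeLabel (n s : ℕ) : Set where
  sink   : Clause n → NodeLabel n s
  -- branch x t e : labelled x, edge labelled x to t, edge labelled ¬x to e
  branch : Fin n → Fin s → Fin s → NodeLabel n s

data Edge {n s} (lab : Fin s → NodeLabel n s) : Fin s → Literal n → Fin s → Set where
  posE : ∀ {u x t e} → lab u ≡ branch x t e → Edge lab u (x , true) t
  negE : ∀ {u x t e} → lab u ≡ branch x t e → Edge lab u (x , false) e

data Path {n s} (lab : Fin s → NodeLabel n s) : Fin s → Fin s → List (Literal n) → Set where
  []  : ∀ {u} → Path lab u u []
  _∷_ : ∀ {u w v ℓ ls} → Edge lab u ℓ w → Path lab w v ls → Path lab u v (ℓ ∷ ls)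

record RRRefutation {n} (φ : CNF n) (s : ℕ) : Set where
  field
    label          : Fin s → NodeLabel n s
    source         : Fin s
    twoOut         : ∀ u x t e → label u ≡ branch x t e → t ≢ e
    acyclic        : ∀ u ls → Path label u u ls → ls ≡ []
    sourceNoIn     : ∀ u ℓ → ¬ Edge label u ℓ source
    othersHaveIn   : ∀ v → v ≢ source → ∃[ u ] ∃[ ℓ ] Edge label u ℓ v
    regular        : ∀ u v ls x t e x′ t′ e′ → Path label u v ls → u ≢ v →
                     label u ≡ branch x t e → label v ≡ branch x′ t′ e′ → x ≢ x′
    sinkOK         : ∀ u C → label u ≡ sink C →
                     C LM.∈ φ × (∀ ls → Path label source u ls → Falsifies ls C)

{-# OPTIONS --safe #-}
-- Let ψ be φ without the p deleted clauses.  A node of the refutation works in a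
-- subtree of the tree decomposition of ψ, with vertex set W, remembering an
-- assignment β of the bag above W and the set S of deleted clauses that may
-- already be satisfied.  It must end in a falsified clause of ψ or in an outcome, i.e. a set containing all deleted
-- clauses satisfied so far, belonging to a down-closed family 𝓓; at the root 𝓓
-- consists of the proper subsets, so that an outcome yields a falsified clause.
--
-- At a join of W₁ and W₂ with |W₂| ≤ |W₁| there are two cases.
--   * 𝓓 is closed under adding what W₁ can satisfy.  Then every deleted clause
--     that matters is false on W₁ in all models of ψ, so its literals in W₁ are
--     queried one after the other; a true one contradicts ψ, which is refuted
--     in linear size, and if all are false the search continues in W₂ alone,
--     with the same 𝓓, and β may be forgotten.
--   * Otherwise W₂ is explored first while β and S are kept in memory, with the
--     residual family of those M that can be completed in W₁; this family is
--     strictly smaller than 𝓓, so the nesting depth is at most 2 ^ p.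
-- Since the copies are made of the smaller side only, the number of nodes
-- satisfies N_h(a + b) ≤ N_h(a) + N_h(b) + c (a + N_{h-1}(b)) with b ≤ a and c
-- depending on k and p only, hence is quadratic.  The linear refutations
-- of ψ are shared by all joins.
module Submission where

open import Defs
open import Data.Bool using (Bool; true; false; not; if_then_else_)
open import Data.Bool.Properties using (not-involutive) renaming (_≟_ to _≟ᵇ_)
open import Data.Empty using (⊥; ⊥-elim)
open import Data.Fin using (Fin; zero; suc; toℕ; fromℕ<; punchIn; punchOut)
open import Data.Fin.Properties using (_≟_; any?; suc-injective; toℕ-injective; toℕ-fromℕ<; toℕ<n; punchIn-mono-≤; punchIn-punchOut)
open import Data.Fin.Subset using (Subset; ∣_∣; inside; outside) renaming (_∪_ to _⊔_; _⊆_ to _⊆ˢ_; ⊤ to fullˢ; ⊥ to emptyˢ)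
import Data.Fin.Subset as Subset
open import Data.Fin.Subset.Properties using (anySubset?; x∈p∪q⁻; p⊆p∪q; q⊆p∪q; ∈⊤; ∉⊥)
import Data.Fin.Subset.Properties as SubsetP
open import Data.List using (List; []; _∷_; _++_; length; map; filter; foldr; allFin; cartesianProduct)
import Data.List as List
open import Data.List.Membership.Propositional using (_∈_; _∉_; find)
import Data.List.Membership.DecPropositional as DecMembership
open import Data.List.Membership.Propositional.Properties using (∈-++⁺ˡ; ∈-++⁺ʳ; ∈-++⁻; ∈-map⁺; ∈-map⁻; ∈-filter⁺; ∈-filter⁻; ∈-allFin; ∈-cartesianProduct⁺; ∈-lookup)
open import Data.List.Properties using (length-map; length-++; length-filter; length-tabulate)
import Data.List.Relation.Unary.All as All
import Data.List.Relation.Unary.All.Properties as AllP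
open import Data.List.Relation.Unary.Any using (here; there)
import Data.List.Relation.Unary.Any as Any
import Data.List.Relation.Unary.Any.Properties as AnyP
open import Data.List.Relation.Unary.Unique.Propositional using (Unique; []; _∷_)
import Data.List.Relation.Unary.Unique.Propositional.Properties as UniqueP
open import Data.Maybe using (Maybe; just; nothing)
open import Data.Maybe.Properties using (≡-dec)
open import Data.Nat using (ℕ; zero; suc; _≤_; _<_; _+_; _*_; _^_; z≤n; s≤s)
import Data.Nat.Properties as ℕP
open import Data.Nat.Tactic.RingSolver using (solve-∀)
open import Data.Product using (Σ; ∃; ∃-syntax; _×_; _,_; proj₁; proj₂)
open import Data.Sum using (_⊎_; inj₁; inj₂; [_,_]′)
import Data.Sum as Sum
open import Data.Unit using (⊤; tt)
open import Data.Vec using (Vec; []; _∷_; lookup; tabulate; replicate; _[_]≔_)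
import Data.Vec as Vec
open import Data.Vec.Properties using (lookup∘tabulate; lookup⇒[]=; []=⇒lookup; lookup∘update; lookup∘update′)
open import Function using (_∘_; id; case_of_)
open import Relation.Binary.PropositionalEquality using (_≡_; _≢_; refl; sym; trans; cong; cong₂; subst)
open import Relation.Nullary using (¬_; Dec; yes; no; does; ¬?)
open import Relation.Nullary.Decidable using (_×-dec_; _⊎-dec_; _→-dec_; map′; decidable-stable; dec-true; dec-false)
open import Relation.Unary using (_∪_; _⊆_; ∅; ｛_｝; _∖_; Decidable)

-- From derivations to refutations

LitSet : ℕ → Set₁
LitSet n = Literal n → Set

VarSet : ℕ → Set₁
VarSet n = Fin n → Set

module Derivation {n} (φ : CNF n) where

  -- A node of a refutation under construction: literals that every path
  -- reaching the node must have set, and variables it may still query.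
  record Label : Set₁ where
    constructor ⟨_,_⟩
    field
      lits : LitSet n
      free : VarSet n
  open Label

  -- A node labelled `q` may stand wherever `r` is demanded: it relies on fewer literals and queries
  -- fewer variables below it.
  _≼_ : Label → Label → Set
  q ≼ r = (lits q ⊆ lits r) × (free q ⊆ free r)

  ≼-trans : ∀ {q r s} → q ≼ r → r ≼ s → q ≼ s
  ≼-trans (a , b) (c , d) = (λ x → c (a x)) , (λ x → d (b x))

  data Covers (Γ : List Label) (q : Label) : Set where
    at : (i : Fin (length Γ)) → List.lookup Γ i ≼ q → Covers Γ q

  -- Taking the queried variable out of `free` is what makes the refutation regular.
  child : Label → Literal n → Label
  child q ℓ = ⟨ lits q ∪ ｛ ℓ ｝ , free q ∖ ｛ proj₁ ℓ ｝ ⟩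

  FalsifiedBy : LitSet n → Clause n → Set
  FalsifiedBy ρ C = ∀ ℓ → ℓ ∈C C → ρ (negLit ℓ)

  data Justified (P : Label → Set) (q : Label) : Set where
    leaf  : ∀ C → C ∈ φ → FalsifiedBy (lits q) C → Justified P q
    query : ∀ x → free q x → P (child q (x , true)) → P (child q (x , false)) →
            Justified P q

  -- Each node is justified by nodes in the tail, so the list is in topological order, parents
  -- before children.
  data Deriv : List Label → Set₁ where
    []  : Deriv []
    _∷_ : ∀ {q Γ} → Justified (Covers Γ) q → Deriv Γ → Deriv (q ∷ Γ)

  -- A refutation graph that may still have several sources. The labels in `info` turn conditions on
  -- paths into conditions on single edges, and `forward` gives acyclicity.
  record DAG (s : ℕ) : Set₁ where
    field
      label    : Fin s → NodeLabel n s
      info     : Fin s → Label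
      twoOut   : ∀ {u x t e} → label u ≡ branch x t e → t ≢ e
      forward  : ∀ {u ℓ v} → Edge label u ℓ v → toℕ u < toℕ v
      edge-≼   : ∀ {u ℓ v} → Edge label u ℓ v → info v ≼ child (info u) ℓ
      query-ok : ∀ {u x t e} → label u ≡ branch x t e → free (info u) x
      sink-ok  : ∀ {u C} → label u ≡ sink C → C ∈ φ × FalsifiedBy (lits (info u)) C

  emptyDAG : DAG 0
  emptyDAG = record
    { label = λ () ; info = λ () ; twoOut = λ { {()} } ; forward = λ { {()} }
    ; edge-≼ = λ { {()} } ; query-ok = λ { {()} } ; sink-ok = λ { {()} } }

  shift : ∀ {s} → NodeLabel n s → NodeLabel n (suc s)
  shift (sink C)       = sink C
  shift (branch x t e) = branch x (suc t) (suc e)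

  shift-sink : ∀ {s C} (l : NodeLabel n s) → shift l ≡ sink C → l ≡ sink C
  shift-sink (sink _) refl = refl

  shift-branch : ∀ {s x t e} (l : NodeLabel n s) → shift l ≡ branch x t e →
                 ∃[ t′ ] ∃[ e′ ] (t ≡ suc t′ × e ≡ suc e′ × l ≡ branch x t′ e′)
  shift-branch (branch _ _ _) refl = _ , _ , refl , refl , refl

  module _ {s} (g : DAG s) (q : Label) where
    open DAG g

    consLabel : NodeLabel n s → Fin (suc s) → NodeLabel n (suc s)
    consLabel l zero    = shift l
    consLabel l (suc u) = shift (label u)

    consInfo : Fin (suc s) → Label
    consInfo zero    = q
    consInfo (suc u) = info u

    consEdge : ∀ {l u ℓ v} → Edge (consLabel l) (suc u) ℓ v →
               ∃[ v′ ] (v ≡ suc v′ × Edge label u ℓ v′)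
    consEdge {u = u} (posE eq) with shift-branch (label u) eq
    ... | _ , _ , refl , refl , eq′ = _ , refl , posE eq′
    consEdge {u = u} (negE eq) with shift-branch (label u) eq
    ... | _ , _ , refl , refl , eq′ = _ , refl , negE eq′

    consDAG : (l : NodeLabel n s) →
              (∀ {x t e} → l ≡ branch x t e → t ≢ e × free q x ×
                 info t ≼ child q (x , true) × info e ≼ child q (x , false)) →
              (∀ {C} → l ≡ sink C → C ∈ φ × FalsifiedBy (lits q) C) → DAG (suc s)
    consDAG l hb hs = record
      { label = consLabel l ; info = consInfo ; twoOut = λ {u} → twoOut′ {u} ; forward = forward′
      ; edge-≼ = edge′ ; query-ok = λ {u} → query′ {u} ; sink-ok = λ {u} → sink′ {u} }
      where
      twoOut′ : ∀ {u x t e} → consLabel l u ≡ branch x t e → t ≢ e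
      twoOut′ {zero} eq with shift-branch l eq
      ... | _ , _ , refl , refl , eq′ = proj₁ (hb eq′) ∘ suc-injective
      twoOut′ {suc u} eq with shift-branch (label u) eq
      ... | _ , _ , refl , refl , eq′ = twoOut eq′ ∘ suc-injective
      edge0 : ∀ {ℓ v} → Edge (consLabel l) zero ℓ v →
              ∃[ v′ ] (v ≡ suc v′ × info v′ ≼ child q ℓ)
      edge0 (posE eq) with shift-branch l eq
      ... | _ , _ , refl , refl , eq′ = _ , refl , proj₁ (proj₂ (proj₂ (hb eq′)))
      edge0 (negE eq) with shift-branch l eq
      ... | _ , _ , refl , refl , eq′ = _ , refl , proj₂ (proj₂ (proj₂ (hb eq′)))
      forward′ : ∀ {u ℓ v} → Edge (consLabel l) u ℓ v → toℕ u < toℕ v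
      forward′ {zero} E with edge0 E
      ... | _ , refl , _ = s≤s z≤n
      forward′ {suc u} E with consEdge E
      ... | _ , refl , E′ = s≤s (forward E′)
      edge′ : ∀ {u ℓ v} → Edge (consLabel l) u ℓ v → consInfo v ≼ child (consInfo u) ℓ
      edge′ {zero} E with edge0 E
      ... | _ , refl , h = h
      edge′ {suc u} E with consEdge E
      ... | _ , refl , E′ = edge-≼ E′
      query′ : ∀ {u x t e} → consLabel l u ≡ branch x t e → free (consInfo u) x
      query′ {zero} eq with shift-branch l eq
      ... | _ , _ , _ , _ , eq′ = proj₁ (proj₂ (hb eq′))
      query′ {suc u} eq with shift-branch (label u) eq
      ... | _ , _ , _ , _ , eq′ = query-ok eq′
      sink′ : ∀ {u C} → consLabel l u ≡ sink C → C ∈ φ × FalsifiedBy (lits (consInfo u)) C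
      sink′ {zero}  eq = hs (shift-sink l eq)
      sink′ {suc u} eq = sink-ok (shift-sink (label u) eq)

  DAGCovers : ∀ {s} → DAG s → Label → Set
  DAGCovers {s} g q = Σ (Fin s) λ u → DAG.info g u ≼ q

  -- A node both of whose children are the same is redundant: what holds
  -- below both x and ¬x holds already at the node.
  merge-≼ : ∀ {q r x} → r ≼ child q (x , true) → r ≼ child q (x , false) → r ≼ q
  merge-≼ {q} {r} {x} (a , b) (c , d) = lits≼ , (λ y → proj₁ (b y))
    where
    lits≼ : lits r ⊆ lits q
    lits≼ m with a m | c m
    ... | inj₁ h | _ = h
    ... | inj₂ _ | inj₁ h = h
    ... | inj₂ refl | inj₂ ()

  -- The number of nodes may drop: a query whose children are represented by one node would violate
  -- `twoOut`, and that node then represents the query too.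
  toDAG : ∀ {Γ} → Deriv Γ →
          ∃[ s ] (s ≤ length Γ × Σ (DAG s) λ g → ∀ {q} → Covers Γ q → DAGCovers g q)
  toDAG [] = 0 , z≤n , emptyDAG , λ { (at () _) }
  toDAG (_∷_ {q} {Γ} j d) with toDAG d
  ... | s , s≤ , g , cov = add j
    where
    open DAG g
    Out : Set₁
    Out = ∃[ s′ ] (s′ ≤ suc (length Γ) × Σ (DAG s′) λ g′ → ∀ {r} → Covers (q ∷ Γ) r → DAGCovers g′ r)
    transfer : (g′ : DAG (suc s)) → (∀ u → DAG.info g′ u ≡ consInfo g q u) →
               ∀ {r} → Covers (q ∷ Γ) r → DAGCovers g′ r
    transfer g′ eq {r} (at zero h) = zero , subst (_≼ r) (sym (eq zero)) h
    transfer g′ eq {r} (at (suc i) h) with cov (at i h)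
    ... | u , h′ = suc u , subst (_≼ r) (sym (eq (suc u))) h′
    add : Justified (Covers Γ) q → Out
    add (leaf C C∈ f) = suc s , s≤s s≤ , g′ , transfer g′ (λ _ → refl)
      where g′ = consDAG g q (sink C) (λ ()) (λ { refl → C∈ , f })
    add (query x fx t e) with cov t | cov e
    ... | t′ , ht | e′ , he with t′ ≟ e′
    ... | no t≢e = suc s , s≤s s≤ , g′ , transfer g′ (λ _ → refl)
      where g′ = consDAG g q (branch x t′ e′) (λ { refl → t≢e , fx , ht , he }) (λ ())
    ... | yes refl = s , ℕP.m≤n⇒m≤1+n s≤ , g ,
      λ { (at zero h) → t′ , ≼-trans (merge-≼ ht he) h ; (at (suc i) h) → cov (at i h) }

  -- Pruning to a single source

  HasIn : ∀ {s} → DAG s → Fin s → Set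
  HasIn g v = ∃[ u ] ∃[ ℓ ] Edge (DAG.label g) u ℓ v

  hasIn? : ∀ {s} (g : DAG s) v → Dec (HasIn g v)
  hasIn? g v = any? λ u → edgeFrom u
    where
    open DAG g
    edgeFrom : ∀ u → Dec (∃[ ℓ ] Edge label u ℓ v)
    edgeFrom u with label u in eq
    ... | sink _ = no λ { (_ , posE eq′) → case trans (sym eq) eq′ of λ ()
                        ; (_ , negE eq′) → case trans (sym eq) eq′ of λ () }
    ... | branch x t e with t ≟ v | e ≟ v
    ... | yes refl | _ = yes (_ , posE eq)
    ... | no _ | yes refl = yes (_ , negE eq)
    ... | no t≢ | no e≢ = no λ
      { (_ , posE eq′) → case trans (sym eq) eq′ of λ { refl → t≢ refl }
      ; (_ , negE eq′) → case trans (sym eq) eq′ of λ { refl → e≢ refl } }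

  module _ {s} (v : Fin (suc s)) where

    Avoids : NodeLabel n (suc s) → Set
    Avoids l = ∀ {x t e} → l ≡ branch x t e → v ≢ t × v ≢ e

    out : (l : NodeLabel n (suc s)) → Avoids l → NodeLabel n s
    out (sink C)       _ = sink C
    out (branch x t e) h = branch x (punchOut (proj₁ (h refl))) (punchOut (proj₂ (h refl)))

    out-sink : ∀ l (h : Avoids l) {C} → out l h ≡ sink C → l ≡ sink C
    out-sink (sink _) _ refl = refl

    out-branch : ∀ l (h : Avoids l) {x t e} → out l h ≡ branch x t e →
                 l ≡ branch x (punchIn v t) (punchIn v e)
    out-branch (branch x t e) h refl = sym (cong₂ (branch x)
      (punchIn-punchOut (proj₁ (h refl))) (punchIn-punchOut (proj₂ (h refl))))

    -- No label points to `v`, so all targets can be renumbered by `punchOut`; monotonicity of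
    -- `punchIn` keeps the edges forward.
    removeNode : (g : DAG (suc s)) → ¬ HasIn g v →
                 Σ (DAG s) λ g′ → ∀ u → DAG.info g′ u ≡ DAG.info g (punchIn v u)
    removeNode g noIn = record
      { label = label′ ; info = λ u → info (punchIn v u)
      ; twoOut = λ eq t≡e → twoOut (out-branch _ _ eq) (cong (punchIn v) t≡e)
      ; forward = λ {u} {_} {w} E → ℕP.≰⇒> λ w≤u →
          ℕP.<⇒≱ (forward (lift E)) (punchIn-mono-≤ v w u w≤u)
      ; edge-≼ = λ E → edge-≼ (lift E)
      ; query-ok = λ eq → query-ok (out-branch _ _ eq)
      ; sink-ok = λ eq → sink-ok (out-sink _ _ eq) } , λ _ → refl
      where
      open DAG g
      avoids : ∀ u → Avoids (label (punchIn v u))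
      avoids u eq = (λ { refl → noIn (_ , _ , posE eq) }) , (λ { refl → noIn (_ , _ , negE eq) })
      label′ : Fin s → NodeLabel n s
      label′ u = out (label (punchIn v u)) (avoids u)
      lift : ∀ {u ℓ w} → Edge label′ u ℓ w → Edge label (punchIn v u) ℓ (punchIn v w)
      lift (posE eq) = posE (out-branch _ _ eq)
      lift (negE eq) = negE (out-branch _ _ eq)

  module _ {s} (g : DAG s) where
    open DAG g

    path-≤ : ∀ {u v ls} → Path label u v ls → toℕ u ≤ toℕ v
    path-≤ []      = ℕP.≤-refl
    path-≤ (E ∷ P) = ℕP.≤-trans (ℕP.<⇒≤ (forward E)) (path-≤ P)

    -- Each edge adds at most its own literal. From a source demanding no literal, this yields the
    -- falsification condition at the sinks.
    path-lits : ∀ {u v ls} → Path label u v ls → lits (info v) ⊆ lits (info u) ∪ (_∈ ls)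
    path-lits []      m = inj₁ m
    path-lits (E ∷ P) m with path-lits P m
    ... | inj₂ m′ = inj₂ (there m′)
    ... | inj₁ m′ with proj₁ (edge-≼ E) m′
    ... | inj₁ h = inj₁ h
    ... | inj₂ h = inj₂ (here (sym h))

    path-free : ∀ {u v ls} → Path label u v ls → free (info v) ⊆ free (info u)
    path-free []      h = h
    path-free (E ∷ P) h = proj₁ (proj₂ (edge-≼ E) (path-free P h))

    edge-var : ∀ {u ℓ v x t e} → label u ≡ branch x t e → Edge label u ℓ v → proj₁ ℓ ≡ x
    edge-var eq (posE eq′) = case trans (sym eq) eq′ of λ { refl → refl }
    edge-var eq (negE eq′) = case trans (sym eq) eq′ of λ { refl → refl }

    toRefutation : (r : Fin s) → (∀ ℓ → ¬ lits (info r) ℓ) →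
                   (∀ v → v ≢ r → HasIn g v) → RRRefutation φ s
    toRefutation r empty reach = record
      { label = label ; source = r
      ; twoOut = λ _ _ _ _ → twoOut
      ; acyclic = acyclic
      ; sourceNoIn = λ u _ E → ℕP.<⇒≱ (forward E) (subst (_≤ toℕ u) (sym r≡0) z≤n)
      ; othersHaveIn = reach
      ; regular = regular
      ; sinkOK = λ u C eq → proj₁ (sink-ok eq) , λ ls P ℓ ℓ∈ →
          [ (λ h → ⊥-elim (empty _ h)) , id ]′ (path-lits P (proj₂ (sink-ok eq) ℓ ℓ∈)) }
      where
      first : ∀ {s} → Fin s → ∃[ z ] (toℕ {s} z ≡ 0)
      first {suc _} _ = zero , refl
      -- Edges increase the index, so node 0 has no incoming edge, and `reach` allows this only for
      -- the source.
      r≡0 : toℕ r ≡ 0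
      r≡0 with first r
      ... | z , z≡0 with z ≟ r
      ... | yes refl = z≡0
      ... | no z≢r with reach z z≢r
      ... | u , _ , E = ⊥-elim (ℕP.n≮0 (subst (toℕ u <_) z≡0 (forward E)))
      acyclic : ∀ u ls → Path label u u ls → ls ≡ []
      acyclic u .[] [] = refl
      acyclic u _ (E ∷ P) = ⊥-elim (ℕP.<⇒≱ (forward E) (path-≤ P))
      regular : ∀ u v ls x t e x′ t′ e′ → Path label u v ls → u ≢ v →
                label u ≡ branch x t e → label v ≡ branch x′ t′ e′ → x ≢ x′
      regular u .u .[] _ _ _ _ _ _ [] u≢v _ _ _ = u≢v refl
      -- The first edge removes `x` from the free variables, which only shrink along the rest of the
      -- path, while a query needs a free variable.
      regular u v _ x t e .x t′ e′ (E ∷ P) _ eq eq′ refl =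
        proj₂ (proj₂ (edge-≼ E) (path-free P (query-ok eq′))) (edge-var eq E)

  -- Nodes without incoming edges, other than `r`, are deleted one at a time; once none is left, `r`
  -- is the only source.
  prune : ∀ s (g : DAG s) (r : Fin s) → (∀ ℓ → ¬ lits (DAG.info g r) ℓ) →
          ∃[ s′ ] (s′ ≤ s × RRRefutation φ s′)
  prune (suc s) g r empty with any? (λ v → ¬? (v ≟ r) ×-dec ¬? (hasIn? g v))
  ... | no all = suc s , ℕP.≤-refl , toRefutation g r empty reach
    where
    reach : ∀ v → v ≢ r → HasIn g v
    reach v v≢r with hasIn? g v
    ... | yes h = h
    ... | no ¬h = ⊥-elim (all (v , v≢r , ¬h))
  ... | yes (v , v≢r , noIn) with removeNode v g noIn
  ... | g′ , eq with prune s g′ (punchOut v≢r) empty′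
    where
    empty′ : ∀ ℓ → ¬ lits (DAG.info g′ (punchOut v≢r)) ℓ
    empty′ ℓ h = empty ℓ (subst (λ q → lits q ℓ)
      (trans (eq _) (cong (DAG.info g) (punchIn-punchOut v≢r))) h)
  ... | s′ , s′≤ , R = s′ , ℕP.m≤n⇒m≤1+n s′≤ , R

  refutation : ∀ {Γ V} → Deriv Γ → Covers Γ ⟨ ∅ , V ⟩ →
               ∃[ s ] (s ≤ length Γ × RRRefutation φ s)
  refutation d c with toDAG d
  ... | s , s≤ , g , cov with cov c
  ... | r , h with prune s g r (λ _ → proj₁ h)
  ... | s′ , s′≤ , R = s′ , ℕP.≤-trans s′≤ s≤ , R

-- Extending derivations by a bounded number of nodes

module Extension {n} (φ : CNF n) where
  open Derivation φ
  open Label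

  _⊑_ : List Label → List Label → Set₁
  Γ ⊑ Δ = ∀ {q} → Covers Γ q → Covers Δ q

  weaken : ∀ {Γ q r} → q ≼ r → Covers Γ q → Covers Γ r
  weaken q≼r (at i h) = at i (≼-trans h q≼r)

  -- The old derivation is kept only in the sense of `⊑`: what was covered stays covered. Positions
  -- in the list never matter, and earlier nodes are shared freely.
  record Ext (Γ : List Label) (N : ℕ) {I : Set} (goal : I → Label) : Set₁ where
    constructor ext
    field
      {Δ}   : List Label
      deriv : Deriv Δ
      mono  : Γ ⊑ Δ
      size  : length Δ ≤ N + length Γ
      goals : ∀ i → Covers Δ (goal i)

  private variable
    Γ : List Label
    M N : ℕ
    I J : Set
    q : I → Label
    r : J → Label

  done : Deriv Γ → (∀ i → Covers Γ (q i)) → Ext Γ 0 q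
  done d c = ext d id ℕP.≤-refl c

  relax : M ≤ N → Ext Γ M q → Ext Γ N q
  relax M≤N (ext d m s g) = ext d m (ℕP.≤-trans s (ℕP.+-monoˡ-≤ _ M≤N)) g

  retarget : Ext Γ N q → (∀ {Δ} → Γ ⊑ Δ → (∀ i → Covers Δ (q i)) → ∀ j → Covers Δ (r j)) →
             Ext Γ N r
  retarget (ext d m s g) f = ext d m s (f m g)

  infixl 1 _>>=_

  _>>=_ : Ext Γ M q →
          (∀ {Δ} → Deriv Δ → Γ ⊑ Δ → (∀ i → Covers Δ (q i)) → Ext Δ N r) →
          Ext Γ (N + M) r
  _>>=_ {M = M} {N = N} (ext d m s g) f with f d m g
  ... | ext d′ m′ s′ g′ = ext d′ (m′ ∘ m)
    (ℕP.≤-trans s′ (ℕP.≤-trans (ℕP.+-monoʳ-≤ N s) (ℕP.≤-reflexive (sym (ℕP.+-assoc N M _))))) g′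

  forEach : ∀ {A : Set} (xs : List A) {I : A → Set} {q : ∀ a → I a → Label} →
            Deriv Γ → (∀ a {Δ} → Deriv Δ → Γ ⊑ Δ → Ext Δ N (q a)) →
            Ext Γ (length xs * N) {Σ A λ a → a ∈ xs × I a} (λ i → q (proj₁ i) (proj₂ (proj₂ i)))
  forEach [] d f = done d λ { (_ , () , _) }
  forEach {Γ = Γ} {N = N} (x ∷ xs) {I} {q} d f = forEach xs d f >>= λ {Δ} d′ m g →
    let open Ext (f x d′ m) in
    ext deriv mono size λ { (_ , here refl , i) → goals i
                          ; (a , there a∈ , i) → mono (g (a , a∈ , i)) }

  addNode : ∀ {q} → Deriv Γ → Justified (Covers Γ) q → Ext Γ 1 {⊤} (λ _ → q)
  addNode d j = ext (j ∷ d) (λ { (at i h) → at (suc i) h }) ℕP.≤-refl (λ _ → at zero (id , id))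

  Falsified : LitSet n → Set
  Falsified ρ = ∃[ C ] (C ∈ φ × FalsifiedBy ρ C)

  addChild : ∀ {q} → Deriv Γ → Falsified (lits q) ⊎ Covers Γ q → Ext Γ 1 {⊤} (λ _ → q)
  addChild d (inj₁ (C , C∈ , f)) = addNode d (leaf C C∈ f)
  addChild d (inj₂ c)            = relax z≤n (done d (λ _ → c))

  -- Three nodes: the query itself and at most one leaf for each value.
  addQuery : ∀ {q x} → Deriv Γ → free q x →
             (∀ b → Falsified (lits (child q (x , b))) ⊎ Covers Γ (child q (x , b))) →
             Ext Γ 3 {⊤} (λ _ → q)
  addQuery {x = x} d fx h =
    addChild d (h true) >>= λ d₁ m₁ c₁ →
    addChild d₁ ([ inj₁ , inj₂ ∘ m₁ ]′ (h false)) >>= λ d₂ m₂ c₂ →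
    addNode d₂ (query x fx (m₂ (c₁ tt)) (c₂ tt))

-- Tree decompositions

infix 4 _∈?_
_∈?_ : ∀ {n} (x : Fin n) xs → Dec (x ∈ xs)
_∈?_ = DecMembership._∈?_ _≟_

elements : ∀ {n} → Subset n → List (Fin n)
elements []            = []
elements (inside ∷ p)  = zero ∷ map suc (elements p)
elements (outside ∷ p) = map suc (elements p)

length-elements : ∀ {n} (p : Subset n) → length (elements p) ≡ ∣ p ∣
length-elements []            = refl
length-elements (inside ∷ p)  = cong suc (trans (length-map suc (elements p)) (length-elements p))
length-elements (outside ∷ p) = trans (length-map suc (elements p)) (length-elements p)

∈-elements⁺ : ∀ {n x} (p : Subset n) → x Subset.∈ p → x ∈ elements p
∈-elements⁺ (inside ∷ p)  Vec.here      = here refl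
∈-elements⁺ (inside ∷ p)  (Vec.there h) = there (∈-map⁺ suc (∈-elements⁺ p h))
∈-elements⁺ (outside ∷ p) (Vec.there h) = ∈-map⁺ suc (∈-elements⁺ p h)

∈-elements⁻ : ∀ {n x} (p : Subset n) → x ∈ elements p → x Subset.∈ p
∈-elements⁻ (inside ∷ p)  (here refl) = Vec.here
∈-elements⁻ (inside ∷ p)  (there h) with ∈-map⁻ suc h
... | _ , h′ , refl = Vec.there (∈-elements⁻ p h′)
∈-elements⁻ (outside ∷ p) h with ∈-map⁻ suc h
... | _ , h′ , refl = Vec.there (∈-elements⁻ p h′)

elements-unique : ∀ {n} (p : Subset n) → Unique (elements p)
elements-unique []            = []
elements-unique (inside ∷ p)  =
  AllP.map⁺ (All.universal (λ _ ()) (elements p)) ∷ UniqueP.map⁺ suc-injective (elements-unique p)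
elements-unique (outside ∷ p) = UniqueP.map⁺ suc-injective (elements-unique p)

length-filter-split : ∀ {A : Set} {P : A → Set} (P? : Decidable P) xs →
                      length (filter (¬? ∘ P?) xs) + length (filter P? xs) ≡ length xs
length-filter-split P? [] = refl
length-filter-split P? (x ∷ xs) with P? x
... | yes _ = trans (ℕP.+-suc _ _) (cong suc (length-filter-split P? xs))
... | no _  = cong suc (length-filter-split P? xs)

module Decomposition {n} (G : Graph n) (G-sym : ∀ {x y} → G x y → G y x) (K : ℕ) where

  Vars : Set
  Vars = List (Fin n)

  record Node (B W : Vars) : Set where
    field
      small    : length B ≤ K
      closed   : ∀ {x y} → x ∈ W → G x y → y ∈ B ⊎ y ∈ W
      disjoint : ∀ {x} → x ∈ B → x ∉ W

  -- TD B W: a decomposition of the subgraph induced by the set W, attached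
  -- to the rest of the graph through the bag B only.
  data TD : Vars → Vars → Set where
    empty : ∀ {B} → TD B []
    intro : ∀ {B B′ W x} → Node B (x ∷ W) → x ∉ W → (∀ {y} → y ∈ B′ → y ∈ x ∷ B) →
            TD B′ W → TD B (x ∷ W)
    join  : ∀ {B W₁ W₂} → Node B (W₁ ++ W₂) → (∀ {x} → x ∈ W₁ → x ∉ W₂) →
            1 ≤ length W₂ → length W₂ ≤ length W₁ →
            TD B W₁ → TD B W₂ → TD B (W₁ ++ W₂)

  TD-closed : ∀ {B W x y} → TD B W → x ∈ W → G x y → y ∈ B ⊎ y ∈ W
  TD-closed (intro nd _ _ _)    = Node.closed nd
  TD-closed (join nd _ _ _ _ _) = Node.closed nd

  TD-disjoint : ∀ {B W x} → TD B W → x ∈ B → x ∉ W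
  TD-disjoint empty               _ ()
  TD-disjoint (intro nd _ _ _)    = Node.disjoint nd
  TD-disjoint (join nd _ _ _ _ _) = Node.disjoint nd

  TD-unique : ∀ {B W} → TD B W → Unique W
  TD-unique empty = []
  TD-unique (intro {W = W} _ x∉W _ t) =
    All.tabulate (λ y∈W x≡y → x∉W (subst (_∈ W) (sym x≡y) y∈W)) ∷ TD-unique t
  TD-unique (join _ d _ _ t₁ t₂) =
    UniqueP.++⁺ (TD-unique t₁) (TD-unique t₂) (λ (a , b) → d a b)

  -- Serves to give both sides of a join the same bag. The change stops at the first `intro`, which
  -- asks only for an inclusion of the child's bag.
  enlargeBag : ∀ {B B₂ W} → (∀ {y} → y ∈ B → y ∈ B₂) → length B₂ ≤ K →
               (∀ {x} → x ∈ B₂ → x ∉ W) → TD B W → TD B₂ W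
  enlargeBag _ _ _ empty = empty
  enlargeBag {B} {B₂} B⊆ small dj (intro {W = W} {x = x} nd x∉ B′⊆ t) = intro
    (record { small = small ; disjoint = dj
            ; closed = λ x∈ g → Sum.map₁ B⊆ (Node.closed nd x∈ g) }) x∉
    (λ y∈ → case B′⊆ y∈ of λ { (here e) → here e ; (there h) → there (B⊆ h) }) t
  enlargeBag B⊆ small dj (join {W₁ = W₁} nd d l₁ l₂ t₁ t₂) = join
    (record { small = small ; disjoint = dj
            ; closed = λ x∈ g → Sum.map₁ B⊆ (Node.closed nd x∈ g) }) d l₁ l₂
    (enlargeBag B⊆ small (λ x∈ x∈W → dj x∈ (∈-++⁺ˡ x∈W)) t₁)
    (enlargeBag B⊆ small (λ x∈ x∈W → dj x∈ (∈-++⁺ʳ W₁ x∈W)) t₂)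

  -- Passing below an introduced vertex moves it from `xs` to `ys`, so all bags on the way stay
  -- inside the original one and respect `K`.
  introAll : ∀ {B W} xs ys → length xs + length ys ≤ K → Unique xs →
             (∀ {x} → x ∈ xs → x ∉ ys) → (∀ {x} → x ∈ xs → x ∉ W) →
             (∀ {y} → y ∈ ys → y ∉ W) →
             (∀ {x y} → x ∈ xs → G x y → y ∈ xs ⊎ y ∈ ys ⊎ y ∈ W) →
             (∀ {y} → y ∈ B → y ∈ xs ⊎ y ∈ ys) → TD B W → TD ys (xs ++ W)
  introAll [] ys small _ _ _ yW _ B⊆ t =
    enlargeBag (λ y∈ → case B⊆ y∈ of λ { (inj₂ h) → h }) small yW t
  introAll {B} {W} (x ∷ xs) ys small (x# ∷ uniq) xy xW yW clo B⊆ t =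
    intro (record
      { small = ℕP.≤-trans (ℕP.m≤n+m (length ys) (suc (length xs))) small
      ; closed = closed
      ; disjoint = λ { z∈ (here refl) → xy (here refl) z∈
                     ; z∈ (there h) → TD-disjoint rec (there z∈) h } })
      x∉ id rec
    where
    x∉xs : x ∉ xs
    x∉xs h = All.lookup x# h refl
    rec : TD (x ∷ ys) (xs ++ W)
    rec = introAll xs (x ∷ ys) (subst (_≤ K) (sym (ℕP.+-suc _ _)) small) uniq
      (λ { z∈ (here refl) → x∉xs z∈ ; z∈ (there h) → xy (there z∈) h })
      (xW ∘ there)
      (λ { (here refl) → xW (here refl) ; (there h) → yW h })
      (λ z∈ g → case clo (there z∈) g of λ
        { (inj₁ (here e)) → inj₂ (inj₁ (here e)) ; (inj₁ (there h)) → inj₁ h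
        ; (inj₂ (inj₁ h)) → inj₂ (inj₁ (there h)) ; (inj₂ (inj₂ h)) → inj₂ (inj₂ h) })
      (λ y∈ → case B⊆ y∈ of λ
        { (inj₁ (here e)) → inj₂ (here e) ; (inj₁ (there h)) → inj₁ h
        ; (inj₂ h) → inj₂ (there h) })
      t
    x∉ : x ∉ xs ++ W
    x∉ h = [ x∉xs , xW (here refl) ]′ (∈-++⁻ xs h)
    closed : ∀ {z y} → z ∈ x ∷ xs ++ W → G z y → y ∈ ys ⊎ y ∈ x ∷ xs ++ W
    closed (here refl) g = case clo (here refl) g of λ
      { (inj₁ h) → inj₂ (∈-++⁺ˡ h) ; (inj₂ (inj₁ h)) → inj₁ h
      ; (inj₂ (inj₂ h)) → inj₂ (∈-++⁺ʳ (x ∷ xs) h) }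
    closed (there h) g = case TD-closed rec h g of λ
      { (inj₁ (here e)) → inj₂ (here e) ; (inj₁ (there h′)) → inj₁ h′ ; (inj₂ h′) → inj₂ (there h′) }

  -- `join` puts the larger side first and forbids an empty second side, so the vertex list of a
  -- union is controlled only up to membership.
  record Union (B W₁ W₂ : Vars) : Set where
    field
      {vars} : Vars
      tree   : TD B vars
      split  : ∀ {x} → x ∈ vars → x ∈ W₁ ⊎ x ∈ W₂
      inˡ    : ∀ {x} → x ∈ W₁ → x ∈ vars
      inʳ    : ∀ {x} → x ∈ W₂ → x ∈ vars

  swapUnion : ∀ {B W₁ W₂} → Union B W₁ W₂ → Union B W₂ W₁
  swapUnion u = record { tree = tree ; split = Sum.swap ∘ split ; inˡ = inʳ ; inʳ = inˡ }
    where open Union u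

  orderedUnion : ∀ {B W₁ W₂} → length B ≤ K → (∀ {x} → x ∈ W₁ → x ∉ W₂) →
                 length W₂ ≤ length W₁ → TD B W₁ → TD B W₂ → Union B W₁ W₂
  orderedUnion {W₂ = []} _ _ _ t₁ _ = record
    { tree = t₁ ; split = inj₁ ; inˡ = id ; inʳ = λ () }
  orderedUnion {B} {W₁} {W₂ = _ ∷ _} small d l t₁ t₂ = record
    { tree = join nd d (s≤s z≤n) l t₁ t₂
    ; split = ∈-++⁻ W₁ ; inˡ = ∈-++⁺ˡ ; inʳ = ∈-++⁺ʳ W₁ }
    where
    nd : Node _ _
    nd = record
      { small = small
      ; closed = λ x∈ g → case ∈-++⁻ W₁ x∈ of λ
          { (inj₁ h) → Sum.map₂ ∈-++⁺ˡ (TD-closed t₁ h g)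
          ; (inj₂ h) → Sum.map₂ (∈-++⁺ʳ W₁) (TD-closed t₂ h g) }
      ; disjoint = λ x∈ h → [ TD-disjoint t₁ x∈ , TD-disjoint t₂ x∈ ]′ (∈-++⁻ W₁ h) }

  union : ∀ {B W₁ W₂} → length B ≤ K → (∀ {x} → x ∈ W₁ → x ∉ W₂) →
          TD B W₁ → TD B W₂ → Union B W₁ W₂
  union {W₁ = W₁} {W₂} small d t₁ t₂ with ℕP.≤-total (length W₂) (length W₁)
  ... | inj₁ l = orderedUnion small d l t₁ t₂
  ... | inj₂ l = swapUnion (orderedUnion small (λ a b → d b a) l t₂ t₁)

  -- From parent pointers to the inductive decomposition

  module FromTree {k} (k<K : suc k ≤ K) (T : TreeDecomposition G k) where
    open TreeDecomposition T

    bagList : Fin (suc m) → Vars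
    bagList t = elements (bag t)

    bag-small : ∀ t → length (bagList t) ≤ K
    bag-small t = subst (_≤ K) (sym (length-elements (bag t))) (ℕP.≤-trans (width t) k<K)

    -- The index `i` stands for the non-root node `suc i`; this is the subtree rooted there.
    data Below (i : Fin m) : Fin (suc m) → Set where
      top  : Below i (suc i)
      down : ∀ {j} → Below i (parent j) → Below i (suc j)

    below-< : ∀ {i t} → Below i t → toℕ i < toℕ t
    below-< top            = ℕP.≤-refl
    below-< (down {j} b)   = ℕP.≤-trans (below-< b) (ℕP.≤-trans (parent≤ j) (ℕP.n≤1+n _))

    -- A walk leaving the subtree of a node passes through its parent.
    walk-parent : ∀ {S : Fin (suc m) → Set} {i a c} → Below i a → toℕ c ≤ toℕ i →
                  WalkIn parent S a c → S (parent i)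
    walk-parent b c≤i here = ⊥-elim (ℕP.<⇒≱ (below-< b) c≤i)
    walk-parent b c≤i (step (j , inj₂ (refl , refl)) s w) = walk-parent (down b) c≤i w
    walk-parent b c≤i (step (j , inj₁ (refl , refl)) s w) with b
    ... | top     = s
    ... | down b′ = walk-parent b′ c≤i w

    -- Indices inside the subtree of `suc i` exceed `i`, so `t` lies outside it and the walk
    -- connecting the occurrences of `x` meets the parent.
    bag-parent : ∀ {x i t} → toℕ t ≤ toℕ i → x ∈ bagList (suc i) → x ∈ bagList t →
                 x ∈ bagList (parent i)
    bag-parent {x} {i} {t} t≤i a b = ∈-elements⁺ (bag (parent i)) (walk-parent top t≤i
      (connected x (suc i) t (∈-elements⁻ (bag (suc i)) a) (∈-elements⁻ (bag t) b)))

    -- The state after the nodes of index > j have been merged into their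
    -- parents: W t collects the variables met only below t.
    record Merged (j : ℕ) : Set where
      field
        W     : Fin (suc m) → Vars
        tree  : ∀ {t} → toℕ t ≤ j → TD (bagList t) (W t)
        cover : ∀ x → ∃[ t ] (toℕ t ≤ j × (x ∈ bagList t ⊎ x ∈ W t))
        edge  : ∀ {x y} → G x y →
                ∃[ t ] (toℕ t ≤ j × ((x ∈ bagList t × y ∈ bagList t) ⊎ x ∈ W t ⊎ y ∈ W t))
        apart : ∀ {x t u} → toℕ t ≤ j → toℕ u ≤ j → x ∈ W t → x ∉ bagList u
        once  : ∀ {x t u} → toℕ t ≤ j → toℕ u ≤ j → x ∈ W t → x ∈ W u → t ≡ u

    start : Merged m
    start = record
      { W = λ _ → [] ; tree = λ _ → empty
      ; cover = λ x → let t , x∈ = vcover x in t , t≤m t , inj₁ (∈-elements⁺ (bag t) x∈)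
      ; edge = λ {x} {y} g → let t , x∈ , y∈ = ecover x y g in
          t , t≤m t , inj₁ (∈-elements⁺ (bag t) x∈ , ∈-elements⁺ (bag t) y∈)
      ; apart = λ _ _ () ; once = λ _ _ () }
      where
      t≤m : ∀ (t : Fin (suc m)) → toℕ t ≤ m
      t≤m t = ℕP.≤-pred (toℕ<n t)

    module _ {j} (j<m : j < m) (M : Merged (suc j)) where
      open Merged M

      private
        i : Fin m
        i = fromℕ< j<m

        i≡j : toℕ i ≡ j
        i≡j = toℕ-fromℕ< j<m

        l q : Fin (suc m)
        l = suc i
        q = parent i

        l≤ : toℕ l ≤ suc j
        l≤ = ℕP.≤-reflexive (cong suc i≡j)

        q≤ : toℕ q ≤ j
        q≤ = ℕP.≤-trans (parent≤ i) (ℕP.≤-reflexive i≡j)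

        up : ∀ {t : Fin (suc m)} → toℕ t ≤ j → toℕ t ≤ suc j
        up = ℕP.m≤n⇒m≤1+n

        old : ∀ {x t} → toℕ t ≤ j → x ∈ bagList l → x ∈ bagList t → x ∈ bagList q
        old t≤ = bag-parent (ℕP.≤-trans t≤ (ℕP.≤-reflexive (sym i≡j)))

        lastOr : ∀ {t} → toℕ t ≤ suc j → toℕ t ≤ j ⊎ t ≡ l
        lastOr t≤ with ℕP.m≤n⇒m<n∨m≡n t≤
        ... | inj₁ (s≤s h) = inj₁ h
        ... | inj₂ h       = inj₂ (toℕ-injective (trans h (cong suc (sym i≡j))))

        -- By `old`, the vertices `xs` of the last bag that its parent lacks occur in no other
        -- remaining bag, so they are introduced now; `ys` is what the parent's bag shares.
        xs ys : Vars
        xs = filter (¬? ∘ (_∈? bagList q)) (bagList l)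
        ys = filter (_∈? bagList q) (bagList l)

        xs⁻ : ∀ {x} → x ∈ xs → x ∈ bagList l × x ∉ bagList q
        xs⁻ = ∈-filter⁻ (¬? ∘ (_∈? bagList q))

        ys⁻ : ∀ {x} → x ∈ ys → x ∈ bagList l × x ∈ bagList q
        ys⁻ = ∈-filter⁻ (_∈? bagList q)

        bag-split : ∀ {x} → x ∈ bagList l → x ∈ xs ⊎ x ∈ ys
        bag-split {x} x∈ with x ∈? bagList q
        ... | yes h = inj₂ (∈-filter⁺ (_∈? bagList q) x∈ h)
        ... | no h  = inj₁ (∈-filter⁺ (¬? ∘ (_∈? bagList q)) x∈ h)

        -- The edge must be witnessed at `l`. A witness elsewhere would put `x` into a remaining
        -- bag, hence into the parent's, or into a merged part, which is apart from all bags.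
        xs-closed : ∀ {x y} → x ∈ xs → G x y → y ∈ xs ⊎ y ∈ ys ⊎ y ∈ W l
        xs-closed {x} {y} x∈ g with xs⁻ x∈ | edge g
        ... | x∈l , x∉q | t , t≤ , e with lastOr t≤ | e
        ... | inj₁ t≤j  | inj₁ (x∈t , _) = ⊥-elim (x∉q (old t≤j x∈l x∈t))
        ... | inj₂ refl | inj₁ (_ , y∈) = Sum.map₂ inj₁ (bag-split y∈)
        ... | _         | inj₂ (inj₁ x∈W) = ⊥-elim (apart t≤ l≤ x∈W x∈l)
        ... | inj₂ refl | inj₂ (inj₂ y∈W) = inj₂ (inj₂ y∈W)
        ... | inj₁ t≤j  | inj₂ (inj₂ y∈W) with TD-closed (tree t≤) y∈W (G-sym g)
        ... | inj₁ x∈t = ⊥-elim (x∉q (old t≤j x∈l x∈t))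
        ... | inj₂ x∈W = ⊥-elim (apart t≤ l≤ x∈W x∈l)

        leafTree : TD ys (xs ++ W l)
        leafTree = introAll xs ys
          (subst (_≤ K) (sym (length-filter-split (_∈? bagList q) (bagList l))) (bag-small l))
          (UniqueP.filter⁺ (¬? ∘ (_∈? bagList q)) (elements-unique (bag l)))
          (λ x∈ y∈ → proj₂ (xs⁻ x∈) (proj₂ (ys⁻ y∈)))
          (λ x∈ x∈W → apart l≤ l≤ x∈W (proj₁ (xs⁻ x∈)))
          (λ y∈ y∈W → apart l≤ l≤ y∈W (proj₁ (ys⁻ y∈)))
          xs-closed bag-split (tree l≤)

        l≢ : ∀ {t} → toℕ t ≤ j → t ≢ l
        l≢ t≤ refl = ℕP.<⇒≱ (ℕP.≤-reflexive (cong suc (sym i≡j))) t≤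

        merged : Union (bagList q) (xs ++ W l) (W q)
        merged = union (bag-small q)
          (λ x∈ x∈Wq → case ∈-++⁻ xs x∈ of λ
            { (inj₁ h) → apart (up q≤) l≤ x∈Wq (proj₁ (xs⁻ h))
            ; (inj₂ h) → l≢ q≤ (once (up q≤) l≤ x∈Wq h) })
          (enlargeBag (proj₂ ∘ ys⁻) (bag-small q)
            (λ y∈ x∈ → case ∈-++⁻ xs x∈ of λ
              { (inj₁ h) → proj₂ (xs⁻ h) y∈
              ; (inj₂ h) → apart l≤ (up q≤) h y∈ })
            leafTree)
          (tree (up q≤))

        W′ : Fin (suc m) → Vars
        W′ t with t ≟ q
        ... | yes _ = Union.vars merged
        ... | no _  = W t

        tree′ : ∀ {t} → toℕ t ≤ j → TD (bagList t) (W′ t)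
        tree′ {t} t≤ with t ≟ q
        ... | yes refl = Union.tree merged
        ... | no _     = tree (up t≤)

        W′⁻ : ∀ {x} t → x ∈ W′ t → x ∈ W t ⊎ (t ≡ q × (x ∈ xs ⊎ x ∈ W l))
        W′⁻ t x∈ with t ≟ q
        ... | no _ = inj₁ x∈
        ... | yes refl with Union.split merged x∈
        ... | inj₁ h = inj₂ (refl , ∈-++⁻ xs h)
        ... | inj₂ h = inj₁ h

        W′⁺ : ∀ {x} t → x ∈ W t → x ∈ W′ t
        W′⁺ t x∈ with t ≟ q
        ... | yes refl = Union.inʳ merged x∈
        ... | no _     = x∈

        W′q : ∀ {x} → x ∈ xs ⊎ x ∈ W l → x ∈ W′ q
        W′q h with q ≟ q
        ... | yes refl = Union.inˡ merged ([ ∈-++⁺ˡ , ∈-++⁺ʳ xs ]′ h)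
        ... | no q≢q   = ⊥-elim (q≢q refl)

      mergeLast : Merged j
      mergeLast = record
        { W = W′ ; tree = tree′ ; cover = cover′ ; edge = edge′ ; apart = apart′ ; once = once′ }
        where
        cover′ : ∀ x → ∃[ t ] (toℕ t ≤ j × (x ∈ bagList t ⊎ x ∈ W′ t))
        cover′ x with cover x
        ... | t , t≤ , h with lastOr t≤ | h
        ... | inj₁ t≤j  | _      = t , t≤j , Sum.map₂ (W′⁺ t) h
        ... | inj₂ refl | inj₂ w = q , q≤ , inj₂ (W′q (inj₂ w))
        ... | inj₂ refl | inj₁ b with bag-split b
        ... | inj₁ h′ = q , q≤ , inj₂ (W′q (inj₁ h′))
        ... | inj₂ h′ = q , q≤ , inj₁ (proj₂ (ys⁻ h′))
        edge′ : ∀ {x y} → G x y →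
                ∃[ t ] (toℕ t ≤ j × ((x ∈ bagList t × y ∈ bagList t) ⊎ x ∈ W′ t ⊎ y ∈ W′ t))
        edge′ g with edge g
        ... | t , t≤ , h with lastOr t≤ | h
        ... | inj₁ t≤j  | _ = t , t≤j , Sum.map₂ (Sum.map (W′⁺ t) (W′⁺ t)) h
        ... | inj₂ refl | inj₂ w = q , q≤ , inj₂ (Sum.map (W′q ∘ inj₂) (W′q ∘ inj₂) w)
        ... | inj₂ refl | inj₁ (a , b) with bag-split a | bag-split b
        ... | inj₁ h′ | _       = q , q≤ , inj₂ (inj₁ (W′q (inj₁ h′)))
        ... | inj₂ _  | inj₁ h′ = q , q≤ , inj₂ (inj₂ (W′q (inj₁ h′)))
        ... | inj₂ a′ | inj₂ b′ = q , q≤ , inj₁ (proj₂ (ys⁻ a′) , proj₂ (ys⁻ b′))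
        apart′ : ∀ {x t u} → toℕ t ≤ j → toℕ u ≤ j → x ∈ W′ t → x ∉ bagList u
        apart′ {t = t} t≤ u≤ x∈ x∈u with W′⁻ t x∈
        ... | inj₁ h = apart (up t≤) (up u≤) h x∈u
        ... | inj₂ (refl , inj₁ h) = proj₂ (xs⁻ h) (old u≤ (proj₁ (xs⁻ h)) x∈u)
        ... | inj₂ (refl , inj₂ h) = apart l≤ (up u≤) h x∈u
        once′ : ∀ {x t u} → toℕ t ≤ j → toℕ u ≤ j → x ∈ W′ t → x ∈ W′ u → t ≡ u
        once′ {t = t} {u} t≤ u≤ a b with W′⁻ t a | W′⁻ u b
        ... | inj₁ a′ | inj₁ b′ = once (up t≤) (up u≤) a′ b′
        ... | inj₂ (refl , _) | inj₂ (refl , _) = refl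
        ... | inj₁ a′ | inj₂ (_ , inj₁ h) = ⊥-elim (apart (up t≤) l≤ a′ (proj₁ (xs⁻ h)))
        ... | inj₁ a′ | inj₂ (_ , inj₂ h) = ⊥-elim (l≢ t≤ (once (up t≤) l≤ a′ h))
        ... | inj₂ (_ , inj₁ h) | inj₁ b′ = ⊥-elim (apart (up u≤) l≤ b′ (proj₁ (xs⁻ h)))
        ... | inj₂ (_ , inj₂ h) | inj₁ b′ = ⊥-elim (l≢ u≤ (once (up u≤) l≤ b′ h))

    mergeAll : ∀ j → j ≤ m → Merged j → Merged 0
    mergeAll zero    _   M = M
    mergeAll (suc j) j<m M = mergeAll j (ℕP.<⇒≤ j<m) (mergeLast j<m M)

    -- Once only the root remains, its whole bag is introduced, which leaves the empty bag on top.
    fromTree : ∃[ W ] (TD [] W × ∀ x → x ∈ W)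
    fromTree = bagList zero ++ W zero , introAll (bagList zero) []
        (subst (_≤ K) (sym (ℕP.+-identityʳ _)) (bag-small zero)) (elements-unique (bag zero))
        (λ _ ()) (λ x∈ h → apart {t = zero} {zero} z≤n z≤n h x∈) (λ ()) clo inj₁ (tree z≤n) , all
      where
      open Merged (mergeAll m ℕP.≤-refl start)
      clo : ∀ {x y} → x ∈ bagList zero → G x y → y ∈ bagList zero ⊎ y ∈ [] ⊎ y ∈ W zero
      clo x∈ g with edge g
      ... | zero , _ , inj₁ (_ , y∈) = inj₁ y∈
      ... | zero , _ , inj₂ (inj₁ x∈W) = ⊥-elim (apart {t = zero} {zero} z≤n z≤n x∈W x∈)
      ... | zero , _ , inj₂ (inj₂ y∈W) = inj₂ (inj₂ y∈W)
      all : ∀ x → x ∈ bagList zero ++ W zero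
      all x with cover x
      ... | zero , _ , inj₁ h = ∈-++⁺ˡ h
      ... | zero , _ , inj₂ h = ∈-++⁺ʳ (bagList zero) h

-- Models and linear refutations of ψ

Asg : ℕ → Set
Asg n = Vec Bool n

vecs : ∀ n → List (Vec Bool n)
vecs zero    = [] ∷ []
vecs (suc n) = map (true ∷_) (vecs n) ++ map (false ∷_) (vecs n)

vecs-complete : ∀ {n} (v : Vec Bool n) → v ∈ vecs n
vecs-complete []          = here refl
vecs-complete (true ∷ v)  = ∈-++⁺ˡ (∈-map⁺ (true ∷_) (vecs-complete v))
vecs-complete {suc n} (false ∷ v) = ∈-++⁺ʳ (map (true ∷_) (vecs n)) (∈-map⁺ (false ∷_) (vecs-complete v))

length-map-++-map : ∀ {A C : Set} (f g : A → C) xs {m} → length xs ≡ 2 ^ m → length (map f xs ++ map g xs) ≡ 2 ^ suc m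
length-map-++-map f g xs {m} eq = trans (length-++ (map f xs)) (cong₂ _+_ (trans (length-map f xs) eq)
  (trans (trans (length-map g xs) eq) (sym (ℕP.+-identityʳ _))))

length-vecs : ∀ n → length (vecs n) ≡ 2 ^ n
length-vecs zero    = refl
length-vecs (suc n) = length-map-++-map _ _ (vecs n) {n} (length-vecs n)

Agree : ∀ {n} → List (Fin n) → Asg n → Asg n → Set
Agree B α β = ∀ {x} → x ∈ B → lookup α x ≡ lookup β x

-- Representatives of all assignments of `B`, false elsewhere, so that their number depends on the
-- bag and not on `n`.
bagAsgs : ∀ {n} → List (Fin n) → List (Asg n)
bagAsgs {n} []  = replicate n false ∷ []
bagAsgs (x ∷ B) = map (_[ x ]≔ true) (bagAsgs B) ++ map (_[ x ]≔ false) (bagAsgs B)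

length-bagAsgs : ∀ {n} (B : List (Fin n)) → length (bagAsgs B) ≡ 2 ^ length B
length-bagAsgs []      = refl
length-bagAsgs (x ∷ B) = length-map-++-map _ _ (bagAsgs B) {length B} (length-bagAsgs B)

update-agree : ∀ {n} (x : Fin n) {B} (α β : Asg n) → Agree B α β → Agree (x ∷ B) (α [ x ]≔ lookup β x) β
update-agree x α β h {y} y∈ with y ≟ x
... | yes refl = lookup∘update x α (lookup β x)
update-agree x α β h (here refl) | no y≢x = ⊥-elim (y≢x refl)
update-agree x α β h (there y∈)  | no y≢x = trans (lookup∘update′ y≢x α (lookup β x)) (h y∈)

bagAsgs-complete : ∀ {n} (B : List (Fin n)) (β : Asg n) → ∃[ β* ] (β* ∈ bagAsgs B × Agree B β* β)
bagAsgs-complete {n} [] β = _ , here refl , λ ()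
bagAsgs-complete (x ∷ B) β with bagAsgs-complete B β
... | β* , β*∈ , h = β* [ x ]≔ lookup β x , mem (lookup β x) , update-agree x β* β h
  where
  mem : ∀ b → β* [ x ]≔ b ∈ bagAsgs (x ∷ B)
  mem true  = ∈-++⁺ˡ (∈-map⁺ (_[ x ]≔ true) β*∈)
  mem false = ∈-++⁺ʳ (map (_[ x ]≔ true) (bagAsgs B)) (∈-map⁺ (_[ x ]≔ false) β*∈)

merge : ∀ {n} → List (Fin n) → Asg n → Asg n → Asg n
merge W α β = tabulate λ x → if does (x ∈? W) then lookup α x else lookup β x

merge-in : ∀ {n} (W : List (Fin n)) α β {x} → x ∈ W → lookup (merge W α β) x ≡ lookup α x
merge-in W α β {x} x∈ = trans (lookup∘tabulate _ x)
  (cong (if_then lookup α x else lookup β x) (dec-true (x ∈? W) x∈))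

merge-out : ∀ {n} (W : List (Fin n)) α β {x} → x ∉ W → lookup (merge W α β) x ≡ lookup β x
merge-out W α β {x} x∉ = trans (lookup∘tabulate _ x)
  (cong (if_then lookup α x else lookup β x) (dec-false (x ∈? W) x∉))

comprehension : ∀ {p} {P : Fin p → Set} → Decidable P → Subset p
comprehension P? = tabulate (does ∘ P?)

∈-comprehension⁺ : ∀ {p} {P : Fin p → Set} (P? : Decidable P) {c} → P c → c Subset.∈ comprehension P?
∈-comprehension⁺ P? {c} h = lookup⇒[]= c _ (trans (lookup∘tabulate _ c) (dec-true (P? c) h))

∈-comprehension⁻ : ∀ {p} {P : Fin p → Set} (P? : Decidable P) {c} → c Subset.∈ comprehension P? → P c
∈-comprehension⁻ P? {c} h with P? c | trans (sym (lookup∘tabulate (does ∘ P?) c)) ([]=⇒lookup h)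
... | yes p | _ = p
... | no _  | ()

_∈C?_ : ∀ {n} (ℓ : Literal n) C → Dec (ℓ ∈C C)
(x , true)  ∈C? (P , N) = x SubsetP.∈? P
(x , false) ∈C? (P , N) = x SubsetP.∈? N

∈C⇒occurs : ∀ {n} {C : Clause n} {x} b → (x , b) ∈C C → occurs x C
∈C⇒occurs true  = inj₁
∈C⇒occurs false = inj₂

occurs? : ∀ {n} (x : Fin n) C → Dec (occurs x C)
occurs? x (P , N) = (x SubsetP.∈? P) ⊎-dec (x SubsetP.∈? N)

Sat : ∀ {n} → Asg n → Clause n → Set
Sat α C = ∃[ x ] ((x , lookup α x) ∈C C)

sat? : ∀ {n} (α : Asg n) C → Dec (Sat α C)
sat? α C = any? λ x → (x , lookup α x) ∈C? C

sat-cong : ∀ {n} (α β : Asg n) {C} → (∀ {x} → occurs x C → lookup α x ≡ lookup β x) → Sat α C → Sat β C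
sat-cong α β {C} h (x , x∈) = x , subst (λ b → (x , b) ∈C C) (h (∈C⇒occurs _ x∈)) x∈

Touches : ∀ {n} → List (Fin n) → Clause n → Set
Touches W C = ∃[ x ] (x ∈ W × occurs x C)

touches? : ∀ {n} (W : List (Fin n)) C → Dec (Touches W C)
touches? W C = any? λ x → (x ∈? W) ×-dec occurs? x C

restrict : ∀ {n} → List (Fin n) → Asg n → LitSet n
restrict B β (x , b) = x ∈ B × lookup β x ≡ b

¬≡⇒≡not : ∀ {a b : Bool} → a ≢ b → a ≡ not b
¬≡⇒≡not {true}  {true}  h = ⊥-elim (h refl)
¬≡⇒≡not {true}  {false} h = refl
¬≡⇒≡not {false} {true}  h = refl
¬≡⇒≡not {false} {false} h = ⊥-elim (h refl)

primal-sym : ∀ {n} {ψ : CNF n} {x y} → PrimalGraph ψ x y → PrimalGraph ψ y x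
primal-sym (x≢y , C , C∈ , ox , oy) = x≢y ∘ sym , C , C∈ , oy , ox

module Search {n} (φ ψ : CNF n) (ψ⊆φ : ∀ {C} → C ∈ ψ → C ∈ φ) (K : ℕ) where
  open Derivation φ public
  open Extension φ public
  open Decomposition (PrimalGraph ψ) primal-sym K public

  -- Only clauses touching `W` count. In a tree their variables all lie in `B` or `W` by
  -- `clause-closed`, which makes the notion local.
  record Model (B W : Vars) (β α : Asg n) : Set where
    constructor model
    field
      agrees    : Agree B α β
      satisfies : ∀ {C} → C ∈ ψ → Touches W C → Sat α C
  open Model

  model? : ∀ B W β α → Dec (Model B W β α)
  model? B W β α = map′
    (λ (a , s) → model (All.lookup a) (λ C∈ → All.lookup s C∈))
    (λ m → All.tabulate (agrees m) , All.tabulate (satisfies m))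
    (All.all? (λ x → lookup α x ≟ᵇ lookup β x) B ×-dec
     All.all? (λ C → touches? W C →-dec sat? α C) ψ)

  model-cong : ∀ {B W β β′ α} → Agree B β β′ → Model B W β α → Model B W β′ α
  model-cong h m = model (λ x∈ → trans (agrees m x∈) (h x∈)) (satisfies m)

  -- Two variables of a clause are adjacent in the primal graph, so closedness passes from edges to
  -- clauses.
  clause-closed : ∀ {B W C y} → TD B W → C ∈ ψ → Touches W C → occurs y C → y ∈ B ⊎ y ∈ W
  clause-closed {y = y} t C∈ (x , x∈ , ox) oy with x ≟ y
  ... | yes refl = inj₂ x∈
  ... | no x≢y   = TD-closed t x∈ (x≢y , _ , C∈ , ox , oy)

  module _ {B B′ W x} (nd : Node B (x ∷ W)) (x∉W : x ∉ W)
           (B′⊆ : ∀ {y} → y ∈ B′ → y ∈ x ∷ B) (t : TD B′ W) (β : Asg n) (b : Bool) where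

    private
      β′ : Asg n
      β′ = β [ x ]≔ b

      β′-x : lookup β′ x ≡ b
      β′-x = lookup∘update x β b

      β′-other : ∀ {y} → y ≢ x → lookup β′ y ≡ lookup β y
      β′-other y≢x = lookup∘update′ y≢x β b

      -- Such a clause contains `x` and otherwise only variables of `B`, so it is decided once `x`
      -- is set.
      Bad : Clause n → Set
      Bad C = Touches (x ∷ W) C × ¬ Touches W C × ¬ Sat β′ C

    restrict-update : restrict B′ β′ ⊆ restrict B β ∪ ｛ (x , b) ｝
    restrict-update {y , c} (y∈ , eq) with y ≟ x
    ... | yes refl = inj₂ (cong (y ,_) (trans (sym β′-x) eq))
    ... | no y≢x with B′⊆ y∈
    ... | here y≡x = ⊥-elim (y≢x y≡x)
    ... | there h  = inj₁ (h , trans (sym (β′-other y≢x)) eq)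

    Extends : Set
    Extends = ∀ {α′} → Model B′ W β′ α′ →
      ∃[ α ] (Model B (x ∷ W) β α × lookup α x ≡ b × Agree W α α′)

    -- If no clause decided by `x` is false, the remaining ones touch `W`; they depend on `B′` and
    -- `W` alone, where the model of the child satisfies them.
    introModel : Falsified (restrict B β ∪ ｛ (x , b) ｝) ⊎ Extends
    introModel with Any.any? (λ C → touches? (x ∷ W) C ×-dec ¬? (touches? W C) ×-dec ¬? (sat? β′ C)) ψ
    ... | yes found = inj₁ (bad (find found))
      where
      bad : ∃[ C ] (C ∈ ψ × Bad C) → Falsified (restrict B β ∪ ｛ (x , b) ｝)
      bad (C , C∈ , (z , z∈ , oz) , ¬W , ¬sat) = C , ψ⊆φ C∈ , false′
        where
        ox : occurs x C
        ox = case z∈ of λ { (here refl) → oz ; (there h) → ⊥-elim (¬W (z , h , oz)) }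
        false′ : FalsifiedBy (restrict B β ∪ ｛ (x , b) ｝) C
        false′ (y , c) ℓ∈ = go (y ≟ x)
          where
          val : lookup β′ y ≡ not c
          val = ¬≡⇒≡not λ eq → ¬sat (y , subst (λ d → (y , d) ∈C C) (sym eq) ℓ∈)
          go : Dec (y ≡ x) → (restrict B β ∪ ｛ (x , b) ｝) (y , not c)
          go (yes refl) = inj₂ (cong (x ,_) (trans (sym β′-x) val))
          go (no y≢x) with Node.closed nd (here refl) (y≢x ∘ sym , C , C∈ , ox , ∈C⇒occurs c ℓ∈)
          ... | inj₁ y∈B = inj₁ (y∈B , trans (sym (β′-other y≢x)) val)
          ... | inj₂ (here y≡x) = ⊥-elim (y≢x y≡x)
          ... | inj₂ (there y∈W) = ⊥-elim (¬W (y , y∈W , ∈C⇒occurs c ℓ∈))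
    ... | no none = inj₂ λ {α′} m → merge W α′ β′ ,
        model (λ {y} y∈B → trans (merge-out W α′ β′ (Node.disjoint nd y∈B ∘ there))
                 (β′-other λ { refl → Node.disjoint nd y∈B (here refl) }))
              (λ {C} → sat′ m C) ,
        trans (merge-out W α′ β′ x∉W) β′-x , merge-in W α′ β′
      where
      sat′ : ∀ {α′} → Model B′ W β′ α′ → ∀ C → C ∈ ψ → Touches (x ∷ W) C → Sat (merge W α′ β′) C
      sat′ {α′} m C C∈ tC with touches? W C
      ... | yes tW = sat-cong α′ (merge W α′ β′) eq (satisfies m C∈ tW)
        where
        eq : ∀ {y} → occurs y C → lookup α′ y ≡ lookup (merge W α′ β′) y
        eq {y} oy with y ∈? W
        ... | yes y∈ = sym (merge-in W α′ β′ y∈)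
        ... | no y∉ with clause-closed t C∈ tW oy
        ... | inj₁ y∈B = trans (agrees m y∈B) (sym (merge-out W α′ β′ y∉))
        ... | inj₂ y∈W = ⊥-elim (y∉ y∈W)
      ... | no ¬tW = sat-cong β′ (merge W α′ β′) (λ oy → sym (merge-out W α′ β′ λ y∈ → ¬tW (_ , y∈ , oy)))
        (decidable-stable (sat? β′ C) λ ¬s → none (Any.map (λ { refl → tC , ¬tW , ¬s }) C∈))

  -- No clause of `ψ` touches both sides, so models over the same bag assignment can be glued.
  joinModel : ∀ {B W₁ W₂ β α₁ α₂} → Node B (W₁ ++ W₂) → (∀ {x} → x ∈ W₁ → x ∉ W₂) →
              TD B W₁ → TD B W₂ → Model B W₁ β α₁ → Model B W₂ β α₂ →
              ∃[ α ] (Model B (W₁ ++ W₂) β α × Agree W₁ α α₁ × Agree W₂ α α₂)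
  joinModel {B} {W₁} {W₂} {β} {α₁} {α₂} nd dj t₁ t₂ m₁ m₂ =
    α , model inB sat′ , in₁ , in₂
    where
    α : Asg n
    α = merge W₁ α₁ (merge W₂ α₂ β)
    α′ : Asg n
    α′ = merge W₂ α₂ β
    in₁ : Agree W₁ α α₁
    in₁ = merge-in W₁ α₁ α′
    in₂ : Agree W₂ α α₂
    in₂ x∈ = trans (merge-out W₁ α₁ α′ λ x∈₁ → dj x∈₁ x∈) (merge-in W₂ α₂ β x∈)
    inB : Agree B α β
    inB x∈ = trans (merge-out W₁ α₁ α′ (Node.disjoint nd x∈ ∘ ∈-++⁺ˡ))
                   (merge-out W₂ α₂ β (Node.disjoint nd x∈ ∘ ∈-++⁺ʳ W₁))
    sat′ : ∀ {C} → C ∈ ψ → Touches (W₁ ++ W₂) C → Sat α C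
    sat′ C∈ (x , x∈ , ox) with ∈-++⁻ W₁ x∈
    ... | inj₁ x∈₁ = sat-cong α₁ α
      (λ oy → [ (λ h → trans (agrees m₁ h) (sym (inB h))) , (λ h → sym (in₁ h)) ]′
        (clause-closed t₁ C∈ (x , x∈₁ , ox) oy)) (satisfies m₁ C∈ (x , x∈₁ , ox))
    ... | inj₂ x∈₂ = sat-cong α₂ α
      (λ oy → [ (λ h → trans (agrees m₂ h) (sym (inB h))) , (λ h → sym (in₂ h)) ]′
        (clause-closed t₂ C∈ (x , x∈₂ , ox) oy)) (satisfies m₂ C∈ (x , x∈₂ , ox))

  data Subtree (B W : Vars) : ∀ {B′ W′} → TD B′ W′ → Set where
    root  : ∀ {t : TD B W} → Subtree B W t
    below : ∀ {B₁ B₂ V x nd x∉} {s : ∀ {y} → y ∈ B₁ → y ∈ x ∷ B₂} {t : TD B₁ V} →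
            Subtree B W t → Subtree B W (intro nd x∉ s t)
    left  : ∀ {B₁ W₁ W₂ nd l l′} {d : ∀ {x} → x ∈ W₁ → x ∉ W₂} {t₁ : TD B₁ W₁} {t₂ : TD B₁ W₂} → Subtree B W t₁ →
            Subtree B W (join nd d l l′ t₁ t₂)
    right : ∀ {B₁ W₁ W₂ nd l l′} {d : ∀ {x} → x ∈ W₁ → x ∉ W₂} {t₁ : TD B₁ W₁} {t₂ : TD B₁ W₂} → Subtree B W t₂ →
            Subtree B W (join nd d l l′ t₁ t₂)

  -- Linear refutations under a partial assignment

  Partial : Set
  Partial = Fin n → Maybe Bool

  Respects : Vars → Partial → Asg n → Set
  Respects W σ α = ∀ {x b} → x ∈ W → σ x ≡ just b → lookup α x ≡ b

  respects? : ∀ W σ α → Dec (Respects W σ α)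
  respects? W σ α = map′ (λ h {x} {b} x∈ eq → to x b (All.lookup h x∈) eq)
      (λ h → All.tabulate λ {x} x∈ → from x (h x∈))
      (All.all? dec W)
    where
    P : Fin n → Set
    P x = σ x ≡ just (not (lookup α x)) → ⊥
    to : ∀ x b → P x → σ x ≡ just b → lookup α x ≡ b
    to x true p eq with lookup α x
    ... | true = refl
    ... | false = ⊥-elim (p eq)
    to x false p eq with lookup α x
    ... | false = refl
    ... | true = ⊥-elim (p eq)
    from : ∀ x → (∀ {b} → σ x ≡ just b → lookup α x ≡ b) → P x
    from x h eq with lookup α x | h eq
    ... | true  | ()
    ... | false | ()
    dec : Decidable P
    dec x = ¬? (≡-dec _≟ᵇ_ (σ x) _)

  Refuted : Partial → Vars → Vars → Asg n → Set
  Refuted σ B W β = ¬ (∃[ α ] (Model B W β α × Respects W σ α))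

  refuted? : ∀ σ B W β → Dec (Refuted σ B W β)
  refuted? σ B W β = ¬? (anySubset? λ α → model? B W β α ×-dec respects? W σ α)

  -- The values of `σ` count as queried on the way here, so only the unset variables of `W` remain
  -- free.
  refState : Partial → Vars → Vars → Asg n → Label
  refState σ B W β =
    ⟨ restrict B β ∪ (λ (x , b) → x ∈ W × σ x ≡ just b) , (λ x → x ∈ W × σ x ≡ nothing) ⟩

  -- Asking for all subtrees at once lets every join in the tree use the same nodes.
  record RefGoal (σ : Partial) {B W} (t : TD B W) : Set where
    constructor refGoal
    field
      {bag vars} : Vars
      subtree    : Subtree bag vars t
      asg        : Asg n
      refuted    : Refuted σ bag vars asg

  refLabel : ∀ {σ B W} {t : TD B W} → RefGoal σ t → Label
  refLabel {σ} g = refState σ bag vars asg where open RefGoal g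

  refCost : ℕ
  refCost = 2 ^ K * 3

  bagAsgs-≤ : ∀ {B : Vars} → length B ≤ K → length (bagAsgs B) ≤ 2 ^ K
  bagAsgs-≤ {B} h = ℕP.≤-trans (ℕP.≤-reflexive (length-bagAsgs B)) (ℕP.^-monoʳ-≤ 2 h)

  -- Dynamic programming: an introduced vertex costs at most three nodes for each bag assignment. A
  -- join costs nothing, since by `joinModel` one of its sides is already refuted.
  refute : ∀ σ {B W} (t : TD B W) {Γ} → Deriv Γ → Ext Γ (refCost * length W) {RefGoal σ t} refLabel
  refute σ {B} empty d = relax z≤n (done d λ
    { (refGoal root β r) → ⊥-elim (r (β , model (λ _ → refl) (λ { _ (_ , () , _) }) , (λ ()))) })
  refute σ (join {W₁ = W₁} {W₂} nd dj l l′ t₁ t₂) d =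
    relax (ℕP.≤-reflexive (trans (ℕP.+-comm (refCost * length W₂) _)
             (trans (sym (ℕP.*-distribˡ-+ refCost (length W₁) _)) (cong (refCost *_) (sym (length-++ W₁))))))
    (refute σ t₁ d >>= λ d₁ m₁ g₁ → retarget (refute σ t₂ d₁) λ m₂ g₂ →
      λ { (refGoal (left s) β r) → m₂ (g₁ (refGoal s β r))
        ; (refGoal (right s) β r) → g₂ (refGoal s β r)
        ; (refGoal root β r) → atRoot (m₂ ∘ g₁) g₂ β r })
    where
    atRoot : ∀ {Δ} → (∀ (i : RefGoal σ t₁) → Covers Δ (refLabel i)) →
             (∀ (i : RefGoal σ t₂) → Covers Δ (refLabel i)) →
             ∀ β → Refuted σ _ (W₁ ++ W₂) β → Covers Δ (refState σ _ (W₁ ++ W₂) β)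
    atRoot g₁ g₂ β r with refuted? σ _ W₁ β | refuted? σ _ W₂ β
    ... | yes r₁ | _ = weaken
      ((λ { (inj₁ h) → inj₁ h ; (inj₂ (h , e)) → inj₂ (∈-++⁺ˡ h , e) }) , (λ (h , e) → ∈-++⁺ˡ h , e))
      (g₁ (refGoal root β r₁))
    ... | no _ | yes r₂ = weaken
      ((λ { (inj₁ h) → inj₁ h ; (inj₂ (h , e)) → inj₂ (∈-++⁺ʳ W₁ h , e) }) , (λ (h , e) → ∈-++⁺ʳ W₁ h , e))
      (g₂ (refGoal root β r₂))
    ... | no s₁ | no s₂ = ⊥-elim (s₁ λ (α₁ , m₁ , ρ₁) → s₂ λ (α₂ , m₂ , ρ₂) →
      let α , m , a₁ , a₂ = joinModel nd dj t₁ t₂ m₁ m₂ in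
      r (α , m , λ x∈ e → case ∈-++⁻ W₁ x∈ of λ
        { (inj₁ h) → trans (a₁ h) (ρ₁ h e) ; (inj₂ h) → trans (a₂ h) (ρ₂ h e) }))
  refute σ {B} (intro {B′ = B′} {W} {x} nd x∉ B′⊆ t) d =
    relax (ℕP.≤-trans (ℕP.+-monoˡ-≤ (refCost * length W) (ℕP.*-monoˡ-≤ 3 (bagAsgs-≤ {B} (Node.small nd))))
             (ℕP.≤-reflexive (sym (ℕP.*-suc refCost (length W)))))
    (refute σ t d >>= λ d₁ m₁ g₁ →
     retarget (forEach (bagAsgs B) {λ β → Refuted σ B (x ∷ W) β} {λ β _ → refState σ B (x ∷ W) β} d₁
        λ β d₂ m₂ → atBag β d₂ (m₂ ∘ g₁))
      λ m₂ g₂ → λ { (refGoal (below s) β r) → m₂ (g₁ (refGoal s β r)) ; (refGoal root β r) → atRoot g₂ β r })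
    where
    atRoot : ∀ {Δ} →
             (∀ (i : Σ (Asg n) λ β → β ∈ bagAsgs B × Refuted σ B (x ∷ W) β) → Covers Δ (refState σ B (x ∷ W) (proj₁ i))) →
             ∀ β → Refuted σ B (x ∷ W) β → Covers Δ (refState σ B (x ∷ W) β)
    atRoot g β r with bagAsgs-complete B β
    ... | β* , β*∈ , eq = weaken
      ((λ { (inj₁ (h , e)) → inj₁ (h , trans (sym (eq h)) e) ; (inj₂ h) → inj₂ h }) , id)
      (g (β* , β*∈ , λ (α , m , ρ) → r (α , model-cong eq m , ρ)))

    atValue : ∀ β b {Δ} → (∀ c → σ x ≡ just c → b ≡ c) → (∀ (i : RefGoal σ t) → Covers Δ (refLabel i)) →
              Refuted σ B (x ∷ W) β →
              Falsified (restrict B β ∪ ｛ (x , b) ｝) ⊎ Covers Δ (refState σ B′ W (β [ x ]≔ b))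
    atValue β b hb g r with introModel nd x∉ B′⊆ t β b
    ... | inj₁ f  = inj₁ f
    ... | inj₂ ex = inj₂ (g (refGoal root (β [ x ]≔ b) λ (α′ , m′ , ρ) →
      let α , m , αx , a = ex m′ in
      r (α , m , λ { (here refl) e → trans αx (hb _ e) ; (there h) e → trans (a h) (ρ h e) })))

    atBag : ∀ β {Δ} → Deriv Δ → (∀ (i : RefGoal σ t) → Covers Δ (refLabel i)) →
            Ext Δ 3 {Refuted σ B (x ∷ W) β} (λ _ → refState σ B (x ∷ W) β)
    atBag β d g with refuted? σ B (x ∷ W) β
    ... | no ¬r = relax z≤n (done d λ r → ⊥-elim (¬r r))
    ... | yes r with σ x in eq
    -- Regularity forbids a second query of `x`; its known value is followed directly, with at most
    -- a leaf to add.
    ... | just b = relax (s≤s z≤n) (retarget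
        (addChild d (Sum.map (λ (C , C∈ , f) → C , C∈ , λ ℓ ℓ∈ → lit⁺ (f ℓ ℓ∈)) (weaken (lits⁺ , free⁺))
          (atValue β b (λ c e → case trans (sym eq) e of λ { refl → refl }) g r)))
        λ _ c _ → c tt)
      where
      lit⁺ : restrict B β ∪ ｛ (x , b) ｝ ⊆ Label.lits (refState σ B (x ∷ W) β)
      lit⁺ (inj₁ h)    = inj₁ h
      lit⁺ (inj₂ refl) = inj₂ (here refl , eq)
      lits⁺ : Label.lits (refState σ B′ W (β [ x ]≔ b)) ⊆ Label.lits (refState σ B (x ∷ W) β)
      lits⁺ (inj₁ h) = lit⁺ (restrict-update nd x∉ B′⊆ t β b h)
      lits⁺ (inj₂ (h , e)) = inj₂ (there h , e)
      free⁺ : Label.free (refState σ B′ W (β [ x ]≔ b)) ⊆ Label.free (refState σ B (x ∷ W) β)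
      free⁺ (h , e) = there h , e
    ... | nothing = retarget (addQuery d (here refl , eq) λ b →
        Sum.map (λ (C , C∈ , f) → C , C∈ , λ ℓ ℓ∈ → Sum.map₁ inj₁ (f ℓ ℓ∈))
          (weaken ((λ { (inj₁ h) → Sum.map₁ inj₁ (restrict-update nd x∉ B′⊆ t β b h)
                      ; (inj₂ (h , e)) → inj₁ (inj₂ (there h , e)) }) ,
                   (λ (h , e) → (there h , e) , λ { refl → x∉ h })))
          (atValue β b (λ c e → case trans (sym eq) e of λ ()) g r))
      λ _ c _ → c tt

-- Exploring a subtree

length-filter-mono : ∀ {A : Set} {P Q : A → Set} (P? : Decidable P) (Q? : Decidable Q) →
                     (∀ {a} → P a → Q a) → ∀ xs → length (filter P? xs) ≤ length (filter Q? xs)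
length-filter-mono P? Q? h [] = z≤n
length-filter-mono P? Q? h (x ∷ xs) with P? x | Q? x
... | yes p | yes q = s≤s (length-filter-mono P? Q? h xs)
... | yes p | no ¬q = ⊥-elim (¬q (h p))
... | no _  | yes _ = ℕP.m≤n⇒m≤1+n (length-filter-mono P? Q? h xs)
... | no _  | no _  = length-filter-mono P? Q? h xs

length-filter-strict : ∀ {A : Set} {P Q : A → Set} (P? : Decidable P) (Q? : Decidable Q) →
                       (∀ {a} → P a → Q a) → ∀ {a xs} → a ∈ xs → Q a → ¬ P a →
                       length (filter P? xs) < length (filter Q? xs)
length-filter-strict P? Q? h {a} {x ∷ xs} (here refl) qa ¬pa with P? x | Q? x
... | yes p | _     = ⊥-elim (¬pa p)
... | no _  | no ¬q = ⊥-elim (¬q qa)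
... | no _  | yes _ = s≤s (length-filter-mono P? Q? h xs)
length-filter-strict P? Q? h {a} {x ∷ xs} (there a∈) qa ¬pa with P? x | Q? x
... | yes p | yes q = s≤s (length-filter-strict P? Q? h a∈ qa ¬pa)
... | yes p | no ¬q = ⊥-elim (¬q (h p))
... | no _  | yes _ = ℕP.m≤n⇒m≤1+n (length-filter-strict P? Q? h a∈ qa ¬pa)
... | no _  | no _  = length-filter-strict P? Q? h a∈ qa ¬pa

length-cartesianProduct : ∀ {A B : Set} (xs : List A) (ys : List B) →
                          length (cartesianProduct xs ys) ≡ length xs * length ys
length-cartesianProduct []       ys = refl
length-cartesianProduct (x ∷ xs) ys = trans (length-++ (map (x ,_) ys))
  (cong₂ _+_ (length-map (x ,_) ys) (length-cartesianProduct xs ys))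

unique-⊆-length : ∀ {n} {xs ys : List (Fin n)} → Unique xs → (∀ {x} → x ∈ xs → x ∈ ys) →
                  length xs ≤ length ys
unique-⊆-length {xs = []} _ _ = z≤n
unique-⊆-length {xs = x ∷ xs} {ys} (x# ∷ u) h = ℕP.≤-trans
  (s≤s (unique-⊆-length u λ z∈ → ∈-filter⁺ other? (h (there z∈)) (λ e → All.lookup x# z∈ (sym e))))
  (ℕP.≤-trans (length-filter-strict other? (λ _ → yes tt) (λ _ → tt) (h (here refl)) tt (λ ¬e → ¬e refl))
    (length-filter (λ _ → yes tt) ys))
  where
  other? : Decidable (_≢ x)
  other? z = ¬? (z ≟ x)

-- A position in the fixed query order: `y` is the current variable and `ys` are those still to
-- come.
data Suffix {A : Set} (y : A) (ys : List A) : List A → Set where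
  here  : Suffix y ys (y ∷ ys)
  there : ∀ {x xs} → Suffix y ys xs → Suffix y ys (x ∷ xs)

module LongClauses {n p} (φ ψ : CNF n) (ψ⊆φ : ∀ {C} → C ∈ ψ → C ∈ φ) (K : ℕ) (D : Fin p → Clause n) where
  open Search φ ψ ψ⊆φ K public

  Hits : Vars → Asg n → Fin p → Set
  Hits W α c = ∃[ x ] (x ∈ W × (x , lookup α x) ∈C D c)

  hits? : ∀ W α → Decidable (Hits W α)
  hits? W α c = any? λ x → (x ∈? W) ×-dec ((x , lookup α x) ∈C? D c)

  hit : Vars → Asg n → Subset p
  hit W α = comprehension (hits? W α)

  hit⁺ : ∀ {W α c} → Hits W α c → c Subset.∈ hit W α
  hit⁺ {W} {α} = ∈-comprehension⁺ (hits? W α)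

  hit⁻ : ∀ {W α c} → c Subset.∈ hit W α → Hits W α c
  hit⁻ {W} {α} = ∈-comprehension⁻ (hits? W α)

  hit-mono : ∀ {W W′ α α′} → (∀ {x} → x ∈ W → x ∈ W′) → Agree W α′ α → hit W α ⊆ˢ hit W′ α′
  hit-mono {W} {W′} {α} {α′} h e c∈ with hit⁻ {W} {α} c∈
  ... | x , x∈ , m = hit⁺ {W′} {α′} (x , h x∈ , subst (λ b → (x , b) ∈C D _) (sym (e x∈)) m)

  -- What is known about the variables of R when no clause outside S is
  -- satisfied by them.
  Unhit : VarSet n → Subset p → LitSet n
  Unhit R S (x , b) = R x × ∃[ c ] (c Subset.∉ S × (x , not b) ∈C D c)

  record Family : Set₁ where
    field
      Member : Subset p → Set
      member? : Decidable Member
      down   : ∀ {S T} → S ⊆ˢ T → Member T → Member S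

    size : ℕ
    size = length (filter member? (vecs p))
  open Family

  ⊔-lub : ∀ {S T U : Subset p} → S ⊆ˢ U → T ⊆ˢ U → S ⊔ T ⊆ˢ U
  ⊔-lub {S} {T} h k c∈ = [ h , k ]′ (x∈p∪q⁻ S T c∈)

  ⊔ˡ : ∀ {S T : Subset p} → S ⊆ˢ S ⊔ T
  ⊔ˡ {T = T} = p⊆p∪q T

  ⊔ʳ : ∀ {S T : Subset p} → T ⊆ˢ S ⊔ T
  ⊔ʳ {S} {T} = q⊆p∪q S T

  Unhit-⊔ : ∀ {R R′ : VarSet n} {S T} → Unhit (R ∪ R′) (S ⊔ T) ⊆ Unhit R S ∪ Unhit R′ T
  Unhit-⊔ (inj₁ r , c , c∉ , m) = inj₁ (r , c , c∉ ∘ ⊔ˡ , m)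
  Unhit-⊔ (inj₂ r , c , c∉ , m) = inj₂ (r , c , c∉ ∘ ⊔ʳ , m)

  Unhit-mono : ∀ {R R′ : VarSet n} {S} → (∀ x → R x → R′ x) → Unhit R S ⊆ Unhit R′ S
  Unhit-mono h (r , m) = h _ r , m

  Occurs∉ : Subset p → Fin n → Bool → Set
  Occurs∉ Z y b = ∃[ c ] (c Subset.∉ Z × (y , b) ∈C D c)

  occurs∉? : ∀ Z y b → Dec (Occurs∉ Z y b)
  occurs∉? Z y b = any? λ c → ¬? (c SubsetP.∈? Z) ×-dec ((y , b) ∈C? D c)

  -- The value making the literals of `y` in clauses outside `Z` false. If both polarities occur
  -- there, false is a placeholder: both values then lead to a refutation of `ψ`.
  forced : Subset p → Partial
  forced Z y with occurs∉? Z y true | occurs∉? Z y false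
  ... | yes _ | _     = just false
  ... | no _  | yes _ = just true
  ... | no _  | no _  = nothing

  forced-just : ∀ Z {y b} → forced Z y ≡ just b → Occurs∉ Z y (not b)
  forced-just Z {y} eq with occurs∉? Z y true | occurs∉? Z y false
  forced-just Z refl | yes o | _     = o
  forced-just Z refl | no _  | yes o = o

  forced-nothing : ∀ Z {y} b → forced Z y ≡ nothing → ¬ Occurs∉ Z y b
  forced-nothing Z {y} b eq with occurs∉? Z y true | occurs∉? Z y false
  forced-nothing Z true  eq | no ¬o | no _  = ¬o
  forced-nothing Z false eq | no _  | no ¬o = ¬o

  -- The variables are queried in a fixed order, ys being those after y: before
  -- y, all literals of clauses outside Z were false, and y has the value b.
  failing : Fin n → Vars → Subset p → Bool → Partial
  failing y ys Z b z with z ≟ y | z ∈? ys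
  ... | yes _ | _     = just b
  ... | no _  | yes _ = nothing
  ... | no _  | no _  = forced Z z

  failing-at : ∀ y ys Z b → failing y ys Z b y ≡ just b
  failing-at y ys Z b with y ≟ y | y ∈? ys
  ... | yes _  | _ = refl
  ... | no y≢y | _ = ⊥-elim (y≢y refl)

  failing-just : ∀ y ys Z b z {v} → failing y ys Z b z ≡ just v →
                 (z ≡ y × b ≡ v) ⊎ (z ∉ y ∷ ys × forced Z z ≡ just v)
  failing-just y ys Z b z eq with z ≟ y | z ∈? ys
  failing-just y ys Z b z refl | yes refl | _   = inj₁ (refl , refl)
  failing-just y ys Z b z eq   | no z≢y | no z∉ = inj₂ ((λ { (here e) → z≢y e ; (there h) → z∉ h }) , eq)

  failing-nothing : ∀ y ys Z b z → failing y ys Z b z ≡ nothing → z ≢ y × (z ∈ ys ⊎ forced Z z ≡ nothing)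
  failing-nothing y ys Z b z eq with z ≟ y | z ∈? ys
  failing-nothing y ys Z b z eq | no z≢y | yes z∈ = z≢y , inj₁ z∈
  failing-nothing y ys Z b z eq | no z≢y | no _   = z≢y , inj₂ eq

  -- The shared refutations that chains branch into. The partial assignments concerned are
  -- determined by a position, a set and a value, so there are `n * 2 ^ p * 2` of them.
  Refs : List Label → ∀ {B W} → TD B W → Set
  Refs Γ t = ∀ {y ys} → Suffix y ys (allFin n) → ∀ Z b (g : RefGoal (failing y ys Z b) t) →
             Covers Γ (refLabel g)

  -- Querying the literals of the deleted clauses

  module Chain {B W} (t : TD B W) (β : Asg n) (Z : Subset p)
               (Z-bound : ∀ {α} → Model B W β α → hit W α ⊆ˢ Z)
               (ρ : LitSet n) (V : VarSet n) (V# : ∀ {x} → x ∈ W → ¬ V x) where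

    -- `xs` are the variables not yet reached. Variables of `W` without a literal outside `Z` also
    -- stay free: the chain skips them, but the refutations branching off may query them.
    chainState : Vars → Label
    chainState xs =
      ⟨ ρ ∪ (restrict B β ∪ Unhit (λ x → x ∈ W × x ∉ xs) Z)
      , V ∪ (λ x → x ∈ W × (x ∈ xs ⊎ forced Z x ≡ nothing)) ⟩

    -- A value satisfying a clause outside `Z` contradicts `Z-bound`, so that branch enters a shared
    -- refutation; any other value continues the chain. Each variable of `W` costs at most one node.
    chain : ∀ xs → Unique xs → (∀ {y ys} → Suffix y ys xs → Suffix y ys (allFin n)) →
            ∀ {Γ} → Deriv Γ → Refs Γ t → Covers Γ (chainState []) →
            Ext Γ (length (filter (_∈? W) xs)) {⊤} (λ _ → chainState xs)
    chain [] _ _ d _ c = done d (λ _ → c)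
    chain (y ∷ ys) (y# ∷ u) suf d refs c with y ∈? W
    ... | no y∉W = retarget (chain ys u (suf ∘ there) d refs c) λ _ g _ → weaken (lits⁺ , free⁺) (g tt)
      where
      lits⁺ : Label.lits (chainState ys) ⊆ Label.lits (chainState (y ∷ ys))
      lits⁺ (inj₁ h) = inj₁ h
      lits⁺ (inj₂ (inj₁ h)) = inj₂ (inj₁ h)
      lits⁺ (inj₂ (inj₂ ((x∈ , x∉) , m))) =
        inj₂ (inj₂ ((x∈ , λ { (here refl) → y∉W x∈ ; (there h) → x∉ h }) , m))
      free⁺ : Label.free (chainState ys) ⊆ Label.free (chainState (y ∷ ys))
      free⁺ (inj₁ h) = inj₁ h
      free⁺ (inj₂ (x∈ , h)) = inj₂ (x∈ , Sum.map₁ there h)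
    ... | yes y∈W with forced Z y in eq
    ... | nothing = relax (ℕP.n≤1+n _)
        (retarget (chain ys u (suf ∘ there) d refs c) λ _ g _ → weaken (lits⁺ , free⁺) (g tt))
      where
      lits⁺ : Label.lits (chainState ys) ⊆ Label.lits (chainState (y ∷ ys))
      lits⁺ (inj₁ h) = inj₁ h
      lits⁺ (inj₂ (inj₁ h)) = inj₂ (inj₁ h)
      lits⁺ (inj₂ (inj₂ ((x∈ , x∉) , o))) = inj₂ (inj₂
        ((x∈ , λ { (here refl) → forced-nothing Z _ eq o ; (there h) → x∉ h }) , o))
      free⁺ : Label.free (chainState ys) ⊆ Label.free (chainState (y ∷ ys))
      free⁺ (inj₁ h) = inj₁ h
      free⁺ (inj₂ (x∈ , h)) = inj₂ (x∈ , Sum.map₁ there h)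
    ... | just v = chain ys u (suf ∘ there) d refs c >>= λ d₁ m₁ g₁ →
        addNode d₁ (query y (inj₂ (y∈W , inj₁ (here refl)))
          (branchTo true (λ Z b g → m₁ (refs (suf here) Z b g)) (g₁ tt))
          (branchTo false (λ Z b g → m₁ (refs (suf here) Z b g)) (g₁ tt)))
      where
      branchTo : ∀ b {Δ} →
                 (∀ Z b (g : RefGoal (failing y ys Z b) t) → Covers Δ (refLabel g)) →
                 Covers Δ (chainState ys) → Covers Δ (child (chainState (y ∷ ys)) (y , b))
      branchTo b ref next with occurs∉? Z y b
      ... | yes (o , o∉ , m) = weaken (lits⁺ , free⁺) (ref Z b (refGoal root β refuted′))
        where
        refuted′ : Refuted (failing y ys Z b) B W β
        refuted′ (α , ma , r) = o∉ (Z-bound ma (hit⁺ {W} {α} (y , y∈W ,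
          subst (λ b → (y , b) ∈C D o) (sym (r y∈W (failing-at y ys Z b))) m)))
        lits⁺ : Label.lits (refState (failing y ys Z b) B W β) ⊆ Label.lits (child (chainState (y ∷ ys)) (y , b))
        lits⁺ (inj₁ h) = inj₁ (inj₂ (inj₁ h))
        lits⁺ {x , _} (inj₂ (x∈ , e)) with failing-just y ys Z b x e
        ... | inj₁ (refl , refl) = inj₂ refl
        ... | inj₂ (x∉ , f) = inj₁ (inj₂ (inj₂ ((x∈ , x∉) , forced-just Z f)))
        free⁺ : Label.free (refState (failing y ys Z b) B W β) ⊆ Label.free (child (chainState (y ∷ ys)) (y , b))
        free⁺ {x} (x∈ , e) with failing-nothing y ys Z b x e
        ... | x≢y , h = inj₂ (x∈ , Sum.map₁ there h) , x≢y ∘ sym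
      ... | no ¬o = weaken (lits⁺ , free⁺) next
        where
        lits⁺ : Label.lits (chainState ys) ⊆ Label.lits (child (chainState (y ∷ ys)) (y , b))
        lits⁺ (inj₁ h) = inj₁ (inj₁ h)
        lits⁺ (inj₂ (inj₁ h)) = inj₁ (inj₂ (inj₁ h))
        lits⁺ {x , w} (inj₂ (inj₂ ((x∈ , x∉) , o))) with x ≟ y
        ... | no x≢y = inj₁ (inj₂ (inj₂ ((x∈ , λ { (here e) → x≢y e ; (there h) → x∉ h }) , o)))
        ... | yes refl = inj₂ (cong (y ,_) (trans (¬≡⇒≡not λ e → ¬o (subst (Occurs∉ Z y) (sym e) o))
                                           (not-involutive w)))
        free⁺ : Label.free (chainState ys) ⊆ Label.free (child (chainState (y ∷ ys)) (y , b))
        free⁺ (inj₁ h) = inj₁ h , λ { refl → V# y∈W h }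
        free⁺ (inj₂ (x∈ , inj₁ h)) = inj₂ (x∈ , inj₁ (there h)) , λ { refl → All.lookup y# h refl }
        free⁺ (inj₂ (x∈ , inj₂ e)) = inj₂ (x∈ , inj₂ e) , λ { refl → case trans (sym e) eq of λ () }

    fullChain : ∀ {Γ} → Deriv Γ → Refs Γ t → Covers Γ (chainState []) →
                Ext Γ (length W) {⊤} (λ _ → ⟨ ρ ∪ restrict B β , V ∪ (_∈ W) ⟩)
    fullChain d refs c = relax bound (retarget (chain (allFin n) (UniqueP.allFin⁺ n) id d refs c)
      λ _ g _ → weaken
        ( (λ { (inj₁ h) → inj₁ h ; (inj₂ (inj₁ h)) → inj₂ h
             ; (inj₂ (inj₂ ((_ , x∉) , _))) → ⊥-elim (x∉ (∈-allFin _)) })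
        , (λ { (inj₁ h) → inj₁ h ; (inj₂ (h , _)) → inj₂ h })) (g tt))
      where
      bound : length (filter (_∈? W) (allFin n)) ≤ length W
      bound = unique-⊆-length (UniqueP.filter⁺ (_∈? W) (UniqueP.allFin⁺ n))
        (λ x∈ → proj₂ (∈-filter⁻ (_∈? W) {xs = allFin n} x∈))

  -- Vacuous when `β` has no model on `W`: the search then can only end in a falsified clause of
  -- `ψ`.
  Ok : Family → Vars → Vars → Subset p → Asg n → Set
  Ok 𝓓 B W S β = ∀ {α} → Model B W β α → Member 𝓓 (S ⊔ hit W α)

  ok? : ∀ 𝓓 B W S β → Dec (Ok 𝓓 B W S β)
  ok? 𝓓 B W S β = map′
    (λ h {α} m → decidable-stable (member? 𝓓 _) λ ¬d → h (α , m , ¬d))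
    (λ h (α , m , ¬d) → ¬d (h m))
    (¬? (anySubset? λ α → model? B W β α ×-dec ¬? (member? 𝓓 (S ⊔ hit W α))))

  record Goal (𝓓 : Family) (B W : Vars) : Set where
    constructor goal
    field
      reached : Subset p
      asg     : Asg n
      ok      : Ok 𝓓 B W reached asg

  -- Three kinds of knowledge: `ρ` is remembered from enclosing explorations, clauses outside `S`
  -- have only false literals on the explored region `R`, and the bag has its values from `β`.
  stateLabel : VarSet n → LitSet n → VarSet n → (B W : Vars) → Subset p → Asg n → Label
  stateLabel R ρ V B W S β = ⟨ ρ ∪ (Unhit R S ∪ restrict B β) , V ∪ (_∈ W) ⟩

  goalLabel : VarSet n → LitSet n → VarSet n → ∀ {𝓓 B W} → Goal 𝓓 B W → Label
  goalLabel R ρ V {𝓓} {B} {W} g = stateLabel R ρ V B W reached asg where open Goal g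

  states : ℕ
  states = 2 ^ p * 2 ^ K

  -- A bag assignment matters only up to agreement on `B`, so at most `states` pairs serve all
  -- goals.
  perState : ∀ {𝓓 B W R ρ V Γ N} → length B ≤ K → Deriv Γ →
             (∀ S β → Ok 𝓓 B W S β → ∀ {Δ} → Deriv Δ → Γ ⊑ Δ →
               Ext Δ N {⊤} (λ _ → stateLabel R ρ V B W S β)) →
             Ext Γ (states * N) {Goal 𝓓 B W} (goalLabel R ρ V)
  perState {𝓓} {B} {W} {R} {ρ} {V} {Γ} {N} small d f = relax (ℕP.*-monoˡ-≤ N bound)
    (retarget (forEach pairs {λ (S , β) → Ok 𝓓 B W S β} {λ (S , β) _ → stateLabel R ρ V B W S β} d atPair)
      λ _ g → λ { (goal S β ok) → lift g S β ok })
    where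
    pairs : List (Subset p × Asg n)
    pairs = cartesianProduct (vecs p) (bagAsgs B)
    bound : length pairs ≤ states
    bound = ℕP.≤-trans (ℕP.≤-reflexive (length-cartesianProduct (vecs p) (bagAsgs B)))
      (ℕP.*-mono-≤ (ℕP.≤-reflexive (length-vecs p)) (bagAsgs-≤ {B} small))
    atPair : ∀ a {Δ} → Deriv Δ → Γ ⊑ Δ →
           Ext Δ N {Ok 𝓓 B W (proj₁ a) (proj₂ a)} (λ _ → stateLabel R ρ V B W (proj₁ a) (proj₂ a))
    atPair (S , β) d m with ok? 𝓓 B W S β
    ... | yes ok = retarget (f S β ok d m) λ _ g _ → g tt
    ... | no ¬ok = relax z≤n (done d λ ok → ⊥-elim (¬ok ok))
    lift : ∀ {Δ} → (∀ (i : Σ (Subset p × Asg n) λ a → a ∈ pairs × Ok 𝓓 B W (proj₁ a) (proj₂ a)) →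
             Covers Δ (stateLabel R ρ V B W (proj₁ (proj₁ i)) (proj₂ (proj₁ i)))) →
           ∀ S β → Ok 𝓓 B W S β → Covers Δ (stateLabel R ρ V B W S β)
    lift g S β ok with bagAsgs-complete B β
    ... | β* , β*∈ , eq = weaken
      ( (λ { (inj₁ h) → inj₁ h ; (inj₂ (inj₁ h)) → inj₂ (inj₁ h)
           ; (inj₂ (inj₂ (x∈ , e))) → inj₂ (inj₂ (x∈ , trans (sym (eq x∈)) e)) }) , id)
      (g ((S , β*) , ∈-cartesianProduct⁺ (vecs-complete S) β*∈ , λ m → ok (model-cong eq m)))

  -- R is the region explored before W, and V what may be queried after W; the
  -- last hypothesis says that Γ can go on from every outcome.
  Explore : (ℕ → Set) → ∀ {B W} → TD B W → ℕ → Set₁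
  Explore Bound {B} {W} t N =
    ∀ 𝓓 → Bound (size 𝓓) → ∀ R ρ V → (∀ {x} → x ∈ W → ¬ V x) →
    ∀ {Γ} → Deriv Γ → Refs Γ t →
    (∀ {S} → Member 𝓓 S → Covers Γ ⟨ ρ ∪ Unhit (R ∪ (_∈ W)) S , V ⟩) →
    Ext Γ N {Goal 𝓓 B W} (goalLabel R ρ V)

  exploreEmpty : ∀ {Bound B} → Explore Bound (empty {B}) 0
  exploreEmpty 𝓓 _ R ρ V _ d _ out = done d λ
    { (goal S β ok) → weaken
      ( (λ { (inj₁ h) → inj₁ h ; (inj₂ (inj₁ r , h)) → inj₂ (inj₁ (r , h)) ; (inj₂ (inj₂ () , _)) })
      , inj₁)
      -- Over no variables `β` is itself a model, so `ok` puts `S` into `𝓓`.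
      (out (down 𝓓 (⊔ˡ {S}) (ok {β} (model (λ _ → refl) λ { _ (_ , () , _) })))) }

  -- Each state queries `x` once; `x` then counts as explored, and the clauses its value satisfies
  -- join `S`.
  exploreIntro : ∀ {Bound B B′ W x N} (nd : Node B (x ∷ W)) (x∉ : x ∉ W)
                 (B′⊆ : ∀ {y} → y ∈ B′ → y ∈ x ∷ B) (t : TD B′ W) →
                 Explore Bound t N → Explore Bound (intro nd x∉ B′⊆ t) (states * 3 + N)
  exploreIntro {Bound} {B} {B′} {W} {x} {N} nd x∉ B′⊆ t rec 𝓓 bd R ρ V V# {Γ} d refs out =
    rec 𝓓 bd (R ∪ ｛ x ｝) ρ V (V# ∘ there) d
      (λ s Z b g → refs s Z b (refGoal (below (RefGoal.subtree g)) (RefGoal.asg g) (RefGoal.refuted g)))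
      (λ S∈ → weaken ((λ { (inj₁ h) → inj₁ h ; (inj₂ h) → inj₂ (Unhit-mono (λ y → assoc {y}) h) }) , id) (out S∈))
    >>= λ d₁ m₁ g₁ → perState (Node.small nd) d₁ λ S β ok d₂ m₂ →
      addQuery d₂ (inj₂ (here refl)) λ b →
        Sum.map (λ (C , C∈ , f) → C , C∈ , λ ℓ ℓ∈ → Sum.map₁ (inj₂ ∘ inj₂) (f ℓ ℓ∈)) id
          (atValue S β ok b (m₂ ∘ g₁))
    where
    assoc : R ∪ (_∈ x ∷ W) ⊆ (R ∪ ｛ x ｝) ∪ (_∈ W)
    assoc (inj₁ r) = inj₁ (inj₁ r)
    assoc (inj₂ (here e)) = inj₁ (inj₂ (sym e))
    assoc (inj₂ (there h)) = inj₂ h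
    atValue : ∀ S β → Ok 𝓓 B (x ∷ W) S β → ∀ b {Δ} →
              (∀ (g : Goal 𝓓 B′ W) → Covers Δ (goalLabel (R ∪ ｛ x ｝) ρ V g)) →
              Falsified (restrict B β ∪ ｛ (x , b) ｝) ⊎
              Covers Δ (child (stateLabel R ρ V B (x ∷ W) S β) (x , b))
    atValue S β ok b g with introModel nd x∉ B′⊆ t β b
    ... | inj₁ f  = inj₁ f
    ... | inj₂ ex = inj₂ (weaken (lits⁺ , free⁺) (g (goal S′ β′ ok′)))
      where
      β′ : Asg n
      β′ = β [ x ]≔ b
      S′ : Subset p
      S′ = S ⊔ hit (x ∷ []) β′
      ok′ : Ok 𝓓 B′ W S′ β′
      ok′ {α′} m′ with ex m′
      ... | α , m , αx , a = down 𝓓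
        (⊔-lub (⊔-lub ⊔ˡ (λ c∈ → ⊔ʳ {S} (hit-mono {x ∷ []} {x ∷ W} {β′} {α}
                  (λ { (here e) → here e }) (λ { (here refl) → trans αx (sym (lookup∘update x β b)) }) c∈)))
                (λ c∈ → ⊔ʳ {S} (hit-mono {W} {x ∷ W} {α′} {α} there a c∈)))
        (ok m)
      lits⁺ : ρ ∪ (Unhit (R ∪ ｛ x ｝) S′ ∪ restrict B′ β′) ⊆
              (ρ ∪ (Unhit R S ∪ restrict B β)) ∪ ｛ (x , b) ｝
      lits⁺ (inj₁ h) = inj₁ (inj₁ h)
      lits⁺ (inj₂ (inj₂ h)) = Sum.map₁ (inj₂ ∘ inj₂) (restrict-update nd x∉ B′⊆ t β b h)
      lits⁺ (inj₂ (inj₁ (inj₁ r , c , c∉ , m))) = inj₁ (inj₂ (inj₁ (r , c , c∉ ∘ ⊔ˡ , m)))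
      -- A clause outside `S′` is not satisfied by `x`, so the literal demanded of `x` is the one
      -- just set.
      lits⁺ {_ , w} (inj₂ (inj₁ (inj₂ refl , c , c∉ , m))) = inj₂ (cong (x ,_)
        (trans (¬≡⇒≡not λ e → c∉ (⊔ʳ {S} (hit⁺ {x ∷ []} {β′} (x , here refl ,
                  subst (λ v → (x , v) ∈C D c) (sym (trans (lookup∘update x β b) e)) m))))
               (not-involutive w)))
      free⁺ : V ∪ (_∈ W) ⊆ Label.free (child (stateLabel R ρ V B (x ∷ W) S β) (x , b))
      free⁺ (inj₁ v) = inj₁ v , λ { refl → V# (here refl) v }
      free⁺ (inj₂ h) = inj₂ (there h) , λ { refl → x∉ h }

  -- Passive and active sides of a join

  module _ (B W : Vars) (β : Asg n) where

    private
      collect : List (Asg n) → Subset p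
      collect = foldr (λ α S → hit W α ⊔ S) emptyˢ

    allHit : Subset p
    allHit = collect (filter (model? B W β) (vecs n))

    hit⊆allHit : ∀ {α} → Model B W β α → hit W α ⊆ˢ allHit
    hit⊆allHit {α} m = go (∈-filter⁺ (model? B W β) (vecs-complete α) m)
      where
      go : ∀ {αs} → α ∈ αs → hit W α ⊆ˢ collect αs
      go (here refl)         c∈ = ⊔ˡ c∈
      go (there {x = α′} h)  c∈ = ⊔ʳ {hit W α′} (go h c∈)

    Passive : Family → Set
    Passive 𝓓 = ∀ {α T} → Model B W β α → Member 𝓓 T → Member 𝓓 (T ⊔ hit W α)

    -- Passivity adds the clauses of one model at a time; it is iterated over all models.
    passive-allHit : ∀ {𝓓 T} → Passive 𝓓 → Member 𝓓 T → Member 𝓓 (T ⊔ allHit)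
    passive-allHit {𝓓} pas T∈ = go (filter (model? B W β) (vecs n))
        (λ h → proj₂ (∈-filter⁻ (model? B W β) {xs = vecs n} h)) T∈
      where
      go : ∀ αs → (∀ {α} → α ∈ αs → Model B W β α) → ∀ {T} → Member 𝓓 T → Member 𝓓 (T ⊔ collect αs)
      go [] _ {T} T∈ = down 𝓓 (⊔-lub id (λ c∈ → ⊥-elim (∉⊥ c∈))) T∈
      go (α ∷ αs) ms {T} T∈ = down 𝓓
        (⊔-lub (⊔ˡ ∘ ⊔ˡ) (⊔-lub (λ c∈ → ⊔ˡ {T ⊔ hit W α} (⊔ʳ {T} c∈)) (⊔ʳ {T ⊔ hit W α})))
        (go αs (ms ∘ there) (pas (ms (here refl)) T∈))

    Active : Family → Set
    Active 𝓓 = ∃[ α ] (Model B W β α × ∃[ T ] (Member 𝓓 T × ¬ Member 𝓓 (T ⊔ hit W α)))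

    passiveOrActive : ∀ 𝓓 → Passive 𝓓 ⊎ Active 𝓓
    passiveOrActive 𝓓 with anySubset? (λ α → model? B W β α ×-dec
                             anySubset? (λ T → member? 𝓓 T ×-dec ¬? (member? 𝓓 (T ⊔ hit W α))))
    ... | yes a = inj₂ a
    ... | no ¬a = inj₁ λ {α} {T} m T∈ →
      decidable-stable (member? 𝓓 _) λ ¬d → ¬a (α , m , T , T∈ , ¬d)

    -- Outcomes on the other side of a join after which every model on this side still leads into
    -- `𝓓`.
    residual : Family → Subset p → Family
    residual 𝓓 S = record
      { Member = λ M → Ok 𝓓 B W (S ⊔ M) β
      ; member? = λ M → ok? 𝓓 B W (S ⊔ M) β
      ; down = λ {M} {M′} h ok m → down 𝓓
          (⊔-lub (⊔-lub (λ c∈ → ⊔ˡ {S ⊔ M′} (⊔ˡ {S} c∈)) (λ c∈ → ⊔ˡ {S ⊔ M′} (⊔ʳ {S} (h c∈))))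
                 (⊔ʳ {S ⊔ M′})) (ok m) }

    -- The active model serves twice: its existence makes residual members belong to `𝓓`, and its
    -- set `T` is a member of `𝓓` that the residual family loses.
    residual-size : ∀ 𝓓 S → Active 𝓓 → size (residual 𝓓 S) < size 𝓓
    residual-size 𝓓 S (α , m , T , T∈ , ¬d) = length-filter-strict
      (member? (residual 𝓓 S)) (member? 𝓓)
      (λ {M} ok → down 𝓓 (λ c∈ → ⊔ˡ {S ⊔ M} (⊔ʳ {S} c∈)) (ok m))
      (vecs-complete T) T∈
      (λ ok → ¬d (down 𝓓 (⊔-lub (λ c∈ → ⊔ˡ {S ⊔ T} (⊔ʳ {S} c∈)) (⊔ʳ {S ⊔ T})) (ok m)))

  -- Each side is explored once for `𝓓`, as the last one visited, with the other side in the
  -- explored region. Each state then reaches one of them by a chain through `W₁` or by a nested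
  -- exploration of `W₂` of cost `M`.
  exploreJoin : ∀ {Bound Bound′ B W₁ W₂ N₁ N₂ M} (nd : Node B (W₁ ++ W₂))
                (dj : ∀ {x} → x ∈ W₁ → x ∉ W₂) l l′ (t₁ : TD B W₁) (t₂ : TD B W₂) →
                (∀ {a b} → Bound b → a < b → Bound′ a) →
                Explore Bound t₁ N₁ → Explore Bound t₂ N₂ → Explore Bound′ t₂ M →
                Explore Bound (join nd dj l l′ t₁ t₂) (states * (length W₁ + M) + N₂ + N₁)
  exploreJoin {Bound} {Bound′} {B} {W₁} {W₂} {N₁} {N₂} {M} nd dj l l′ t₁ t₂ smaller rec₁ rec₂ rec₂′
              𝓓 bd R ρ V V# {Γ} d refs out =
    rec₁ 𝓓 bd (R ∪ (_∈ W₂)) ρ V (V# ∘ ∈-++⁺ˡ) d refs₁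
      (λ S∈ → weaken (Sum.map₂ (Unhit-mono (λ y → swap₁ {y})) , id) (out S∈)) >>= λ d₁ m₁ g₁ →
    rec₂ 𝓓 bd (R ∪ (_∈ W₁)) ρ V (V# ∘ ∈-++⁺ʳ W₁) d₁ (λ s Z b g → m₁ (refs₂ s Z b g))
      (λ S∈ → m₁ (weaken (Sum.map₂ (Unhit-mono (λ y → swap₂ {y})) , id) (out S∈))) >>= λ d₂ m₂ g₂ →
    perState (Node.small nd) d₂ λ S β ok d₃ m₃ →
      atState S β ok d₃ (λ s Z b g → m₃ (m₂ (m₁ (refs₁ s Z b g)))) (λ s Z b g → m₃ (m₂ (m₁ (refs₂ s Z b g))))
        (m₃ ∘ m₂ ∘ g₁) (m₃ ∘ g₂)
    where
    refs₁ : Refs Γ t₁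
    refs₁ s Z b g = refs s Z b (refGoal (left (RefGoal.subtree g)) (RefGoal.asg g) (RefGoal.refuted g))
    refs₂ : Refs Γ t₂
    refs₂ s Z b g = refs s Z b (refGoal (right (RefGoal.subtree g)) (RefGoal.asg g) (RefGoal.refuted g))
    swap₁ : R ∪ (_∈ W₁ ++ W₂) ⊆ (R ∪ (_∈ W₂)) ∪ (_∈ W₁)
    swap₁ (inj₁ r) = inj₁ (inj₁ r)
    swap₁ (inj₂ h) = [ inj₂ , inj₁ ∘ inj₂ ]′ (∈-++⁻ W₁ h)
    swap₂ : R ∪ (_∈ W₁ ++ W₂) ⊆ (R ∪ (_∈ W₁)) ∪ (_∈ W₂)
    swap₂ (inj₁ r) = inj₁ (inj₁ r)
    swap₂ (inj₂ h) = [ inj₁ ∘ inj₂ , inj₂ ]′ (∈-++⁻ W₁ h)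

    module AtState (S : Subset p) (β : Asg n) (ok : Ok 𝓓 B (W₁ ++ W₂) S β) where

      joint : ∀ {α₁ α₂} → Model B W₁ β α₁ → Model B W₂ β α₂ →
              Member 𝓓 (S ⊔ (hit W₁ α₁ ⊔ hit W₂ α₂))
      joint {α₁} {α₂} m₁ m₂ with joinModel nd dj t₁ t₂ m₁ m₂
      ... | α , m , a₁ , a₂ = down 𝓓
        (⊔-lub ⊔ˡ (⊔-lub (λ c∈ → ⊔ʳ {S} (hit-mono {W₁} {W₁ ++ W₂} {α₁} {α} ∈-++⁺ˡ a₁ c∈))
                         (λ c∈ → ⊔ʳ {S} (hit-mono {W₂} {W₁ ++ W₂} {α₂} {α} (∈-++⁺ʳ W₁) a₂ c∈))))
        (ok m)

      module _ {Δ} (d : Deriv Δ) (refs₁ : Refs Δ t₁) (refs₂ : Refs Δ t₂)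
               (g₁ : ∀ (g : Goal 𝓓 B W₁) → Covers Δ (goalLabel (R ∪ (_∈ W₂)) ρ V g))
               (g₂ : ∀ (g : Goal 𝓓 B W₂) → Covers Δ (goalLabel (R ∪ (_∈ W₁)) ρ V g)) where

        -- Every set is acceptable here. The full set demands no knowledge of the region, so `W₁` is
        -- entered at once and `W₂` is skipped.
        noModel : ¬ ∃ (Model B W₁ β) → Covers Δ (stateLabel R ρ V B (W₁ ++ W₂) S β)
        noModel none = weaken
          ( (λ { (inj₁ h) → inj₁ h ; (inj₂ (inj₁ (_ , c , c∉ , _))) → ⊥-elim (c∉ ∈⊤)
               ; (inj₂ (inj₂ h)) → inj₂ (inj₂ h) })
          , Sum.map₂ ∈-++⁺ˡ)
          (g₁ (goal fullˢ β λ m → ⊥-elim (none (_ , m))))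

        passive : ∃ (Model B W₁ β) → Passive B W₁ β 𝓓 →
                  Ext Δ (length W₁) {⊤} (λ _ → stateLabel R ρ V B (W₁ ++ W₂) S β)
        passive (α₁ , m₁) pas = retarget (fullChain d refs₁ (weaken (lits⁺ , inj₁) (g₂ (goal (S ⊔ Z) β ok′))))
            λ _ g _ → weaken
              ( (λ { (inj₁ (inj₁ h)) → inj₁ h ; (inj₁ (inj₂ h)) → inj₂ (inj₁ h) ; (inj₂ h) → inj₂ (inj₂ h) })
              , (λ { (inj₁ (inj₁ h)) → inj₁ h ; (inj₁ (inj₂ h)) → inj₂ (∈-++⁺ʳ W₁ h)
                   ; (inj₂ h) → inj₂ (∈-++⁺ˡ h) }))
              (g tt)
          where
          Z : Subset p
          Z = allHit B W₁ β
          V₂# : ∀ {x} → x ∈ W₁ → ¬ (V ∪ (_∈ W₂)) x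
          V₂# x∈ (inj₁ v) = V# (∈-++⁺ˡ x∈) v
          V₂# x∈ (inj₂ h) = dj x∈ h
          open Chain t₁ β Z (hit⊆allHit B W₁ β) (ρ ∪ Unhit R S) (V ∪ (_∈ W₂)) V₂#
          -- The model `α₁` first gives membership of `S ⊔ hit W₂ α₂`; passivity then adds all that
          -- `W₁` can satisfy.
          ok′ : Ok 𝓓 B W₂ (S ⊔ Z) β
          ok′ {α₂} m₂ = down 𝓓
            (⊔-lub (⊔-lub (λ c∈ → ⊔ˡ {S ⊔ hit W₂ α₂} (⊔ˡ {S} c∈)) (⊔ʳ {S ⊔ hit W₂ α₂}))
                   (λ c∈ → ⊔ˡ {S ⊔ hit W₂ α₂} (⊔ʳ {S} c∈)))
            (passive-allHit B W₁ β {𝓓} pas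
              (down 𝓓 (⊔-lub ⊔ˡ (λ c∈ → ⊔ʳ {S} (⊔ʳ {hit W₁ α₁} c∈))) (joint m₁ m₂)))
          lits⁺ : ρ ∪ (Unhit (R ∪ (_∈ W₁)) (S ⊔ Z) ∪ restrict B β) ⊆ Label.lits (chainState [])
          lits⁺ (inj₁ h) = inj₁ (inj₁ h)
          lits⁺ (inj₂ (inj₂ h)) = inj₂ (inj₁ h)
          lits⁺ (inj₂ (inj₁ h)) with Unhit-⊔ {R} {_∈ W₁} {S} {Z} h
          ... | inj₁ h′ = inj₁ (inj₂ h′)
          ... | inj₂ (x∈ , m) = inj₂ (inj₂ ((x∈ , λ ()) , m))

        active : Active B W₁ β 𝓓 → Ext Δ M {⊤} (λ _ → stateLabel R ρ V B (W₁ ++ W₂) S β)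
        active act = retarget
          (rec₂′ (residual B W₁ β 𝓓 S) (smaller bd (residual-size B W₁ β 𝓓 S act))
            -- The nested search starts with an empty region: all present knowledge becomes memory,
            -- and `W₁` is reserved for later queries.
            (λ _ → ⊥) (ρ ∪ (Unhit R S ∪ restrict B β)) (V ∪ (_∈ W₁))
            (λ { x∈ (inj₁ v) → V# (∈-++⁺ʳ W₁ x∈) v ; x∈ (inj₂ h) → dj h x∈ })
            d refs₂
            (λ {T} ok′ → weaken (lits⁺ , id) (g₁ (goal (S ⊔ T) β ok′))))
          λ _ g _ → weaken
            ( (λ { (inj₁ h) → h ; (inj₂ (inj₁ (() , _))) ; (inj₂ (inj₂ h)) → inj₂ (inj₂ h) })
            , (λ { (inj₁ (inj₁ h)) → inj₁ h ; (inj₁ (inj₂ h)) → inj₂ (∈-++⁺ˡ h)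
                 ; (inj₂ h) → inj₂ (∈-++⁺ʳ W₁ h) }))
            -- The empty set suffices as a start, since `S` is built into the residual family.
            (g (goal emptyˢ β λ {α₂} m₂ {α₁} m₁ → down 𝓓
              (⊔-lub (⊔-lub ⊔ˡ (⊔-lub (λ c∈ → ⊥-elim (∉⊥ c∈)) (λ c∈ → ⊔ʳ {S} (⊔ʳ {hit W₁ α₁} c∈))))
                     (λ c∈ → ⊔ʳ {S} (⊔ˡ c∈)))
              (joint m₁ m₂)))
          where
          lits⁺ : ∀ {T} → ρ ∪ (Unhit (R ∪ (_∈ W₂)) (S ⊔ T) ∪ restrict B β) ⊆
                  (ρ ∪ (Unhit R S ∪ restrict B β)) ∪ Unhit ((λ _ → ⊥) ∪ (_∈ W₂)) T
          lits⁺ (inj₁ h) = inj₁ (inj₁ h)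
          lits⁺ (inj₂ (inj₂ h)) = inj₁ (inj₂ (inj₂ h))
          lits⁺ {T} (inj₂ (inj₁ h)) with Unhit-⊔ {R} {_∈ W₂} {S} {T} h
          ... | inj₁ h′ = inj₁ (inj₂ (inj₁ h′))
          ... | inj₂ (x∈ , m) = inj₂ (inj₂ x∈ , m)

        atState : Ext Δ (length W₁ + M) {⊤} (λ _ → stateLabel R ρ V B (W₁ ++ W₂) S β)
        atState with anySubset? (model? B W₁ β)
        ... | no none = relax z≤n (done d λ _ → noModel none)
        ... | yes some with passiveOrActive B W₁ β 𝓓
        ... | inj₁ pas = relax (ℕP.m≤m+n (length W₁) M) (passive some pas)
        ... | inj₂ act = relax (ℕP.m≤n+m M (length W₁)) (active act)

    open AtState using (atState)

-- Size bounds and the root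

-- Coefficient of the quadratic bound at nesting depth `h` with `c` states: `c * 3` pays for an
-- introduced vertex and for the chains, the recursive term for nested explorations.
weight : ℕ → ℕ → ℕ
weight c zero    = c * 3
weight c (suc h) = c * 3 + c * weight c h

weight-≥ : ∀ c h → c * 3 ≤ weight c h
weight-≥ c zero    = ℕP.≤-refl
weight-≥ c (suc h) = ℕP.m≤m+n _ _

-- With b ≤ a, the cross term 2ab of (a + b)² pays for the extra work at a join.
join-cost : ∀ {a b} c w C → 1 ≤ b → b ≤ a → c + c * w ≤ C →
            c * (a + w * (b * b)) + C * (b * b) + C * (a * a) ≤ C * ((a + b) * (a + b))
join-cost {a} {b} c w C 1≤b b≤a c≤C = begin
  c * (a + w * (b * b)) + C * (b * b) + C * (a * a)
    ≤⟨ ℕP.+-monoˡ-≤ (C * (a * a)) (ℕP.+-monoˡ-≤ (C * (b * b)) (ℕP.*-monoʳ-≤ c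
         (ℕP.+-mono-≤ (subst (_≤ a * b) (ℕP.*-identityʳ a) (ℕP.*-monoʳ-≤ a 1≤b))
                      (ℕP.*-monoʳ-≤ w (ℕP.*-monoˡ-≤ b b≤a))))) ⟩
  c * (a * b + w * (a * b)) + C * (b * b) + C * (a * a)
    ≡⟨ factor c w (a * b) (C * (b * b)) (C * (a * a)) ⟩
  (c + c * w) * (a * b) + C * (b * b) + C * (a * a)
    ≤⟨ ℕP.+-monoˡ-≤ (C * (a * a)) (ℕP.+-monoˡ-≤ (C * (b * b)) (ℕP.*-monoˡ-≤ (a * b) c≤C)) ⟩
  C * (a * b) + C * (b * b) + C * (a * a)
    ≤⟨ ℕP.m≤m+n _ (C * (a * b)) ⟩
  C * (a * b) + C * (b * b) + C * (a * a) + C * (a * b)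
    ≡⟨ square C a b ⟩
  C * ((a + b) * (a + b)) ∎
  where
  open ℕP.≤-Reasoning
  factor : ∀ c w x y z → c * (x + w * x) + y + z ≡ (c + c * w) * x + y + z
  factor = solve-∀
  square : ∀ C a b → C * (a * b) + C * (b * b) + C * (a * a) + C * (a * b) ≡ C * ((a + b) * (a + b))
  square = solve-∀

intro-cost : ∀ {c C} w → c ≤ C → c + C * (w * w) ≤ C * (suc w * suc w)
intro-cost {c} {C} w c≤C = begin
  c + C * (w * w)                    ≤⟨ ℕP.+-monoˡ-≤ (C * (w * w)) c≤C ⟩
  C + C * (w * w)                    ≤⟨ ℕP.m≤m+n _ (C * (w + w)) ⟩
  C + C * (w * w) + C * (w + w)      ≡⟨ square C w ⟩
  C * (suc w * suc w) ∎
  where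
  open ℕP.≤-Reasoning
  square : ∀ C w → C + C * (w * w) + C * (w + w) ≡ C * (suc w * suc w)
  square = solve-∀

-- The summands pay for the exploration, the shared refutations of `ψ` and the leaves at the
-- outcomes.
coefficient : ℕ → ℕ → ℕ
coefficient K p = weight (2 ^ p * 2 ^ K) (2 ^ p) + 2 ^ p * 2 * (2 ^ K * 3) + 2 ^ p

module Refutation {n p} (φ ψ : CNF n) (ψ⊆φ : ∀ {C} → C ∈ ψ → C ∈ φ) (K : ℕ) (D : Fin p → Clause n) where
  open LongClauses φ ψ ψ⊆φ K D
  open Family

  cheaper : ∀ {Bound B W} {t : TD B W} {M N} → M ≤ N → Explore Bound t M → Explore Bound t N
  cheaper M≤N e 𝓓 bd R ρ V V# d refs out = relax M≤N (e 𝓓 bd R ρ V V# d refs out)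

  -- `h` bounds the size of the family and thereby the nesting. At zero a nested exploration would
  -- need a family of negative size, hence the bound `_< 0` and the cost 0.
  explore : ∀ h {B W} (t : TD B W) → Explore (_≤ h) t (weight states h * (length W * length W))
  explore h empty = cheaper {_≤ h} z≤n (exploreEmpty {_≤ h})
  explore h (intro {W = W} nd x∉ B′⊆ t) =
    cheaper {_≤ h} (intro-cost (length W) (weight-≥ states h)) (exploreIntro {_≤ h} nd x∉ B′⊆ t (explore h t))
  explore zero (join {W₁ = W₁} {W₂} nd dj l l′ t₁ t₂) = cheaper {_≤ 0}
    (subst (λ w → states * (length W₁ + 0) + weight states 0 * (length W₂ * length W₂) +
                  weight states 0 * (length W₁ * length W₁) ≤ weight states 0 * (w * w))
       (sym (length-++ W₁))
       (join-cost states 0 (weight states 0) l l′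
         (subst (_≤ weight states 0) (sym (trans (cong (states +_) (ℕP.*-zeroʳ states)) (ℕP.+-identityʳ states)))
           (ℕP.m≤m*n states 3))))
    (exploreJoin {_≤ 0} {_< 0} {M = 0} nd dj l l′ t₁ t₂ (λ b≤0 a<b → ℕP.<-≤-trans a<b b≤0)
      (explore zero t₁) (explore zero t₂) (λ _ ()))
  explore (suc h) (join {W₁ = W₁} {W₂} nd dj l l′ t₁ t₂) = cheaper {_≤ suc h}
    (subst (λ w → states * (length W₁ + weight states h * (length W₂ * length W₂)) +
                  weight states (suc h) * (length W₂ * length W₂) +
                  weight states (suc h) * (length W₁ * length W₁) ≤ weight states (suc h) * (w * w))
       (sym (length-++ W₁))
       (join-cost states (weight states h) (weight states (suc h)) l l′
         (ℕP.+-monoˡ-≤ (states * weight states h) (ℕP.m≤m*n states 3))))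
    (exploreJoin {_≤ suc h} {_≤ h} nd dj l l′ t₁ t₂ (λ b≤ a<b → ℕP.≤-pred (ℕP.≤-trans a<b b≤))
      (explore (suc h) t₁) (explore (suc h) t₂) (explore h t₂))

  record FailGoal (xs : Vars) {B W} (t : TD B W) : Set where
    constructor failGoal
    field
      {y}    : Fin n
      {ys}   : Vars
      suffix : Suffix y ys xs
      Z      : Subset p
      b      : Bool
      ref    : RefGoal (failing y ys Z b) t

  refuteAll : ∀ xs {B W} (t : TD B W) {Γ} → Deriv Γ →
              Ext Γ (length xs * (2 ^ p * 2 * (refCost * length W))) {FailGoal xs t}
                (λ g → refLabel (FailGoal.ref g))
  refuteAll [] t d = done d λ { (failGoal () _ _ _) }
  refuteAll (y ∷ ys) {W = W} t d = refuteAll ys t d >>= λ d₁ m₁ g₁ →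
    relax (ℕP.*-monoˡ-≤ (refCost * length W) (ℕP.≤-reflexive
      (trans (length-cartesianProduct (vecs p) bools) (cong (_* 2) (length-vecs p)))))
    (retarget (forEach (cartesianProduct (vecs p) bools) d₁ (λ (Z , b) d₂ _ → refute (failing y ys Z b) t d₂))
      λ m₂ g₂ → λ { (failGoal here Z b r) → g₂ ((Z , b) , ∈-cartesianProduct⁺ (vecs-complete Z) (b∈ b) , r)
                  ; (failGoal (there s) Z b r) → m₂ (g₁ (failGoal s Z b r)) })
    where
    bools : List Bool
    bools = true ∷ false ∷ []
    b∈ : ∀ b → b ∈ bools
    b∈ true  = here refl
    b∈ false = there (here refl)

  proper : Family
  proper = record
    { Member = λ S → ∃[ c ] (c Subset.∉ S) ; member? = λ S → any? λ c → ¬? (c SubsetP.∈? S)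
    ; down = λ S⊆T (c , c∉) → c , c∉ ∘ S⊆T }

  module _ (D⊆φ : ∀ c → D c ∈ φ) {W} (t : TD [] W) (all : ∀ x → x ∈ W)
           (unsat : ∀ α → (∀ {C} → C ∈ ψ → Sat α C) → ¬ (∀ c → Sat α (D c)))
           (touch : ∀ {C} → C ∈ ψ → Touches W C) where

    -- An outcome misses some `c`. As `W` contains every variable, all literals of `D c` are then
    -- known to be false.
    leaves : Ext [] (2 ^ p * 1) {∃ (Member proper)} (λ (S , _) → ⟨ ∅ ∪ Unhit (∅ ∪ (_∈ W)) S , ∅ ⟩)
    leaves = relax (ℕP.*-monoˡ-≤ 1 (ℕP.≤-reflexive (length-vecs p)))
      (retarget (forEach (vecs p) {Member proper} {λ S _ → ⟨ ∅ ∪ Unhit (∅ ∪ (_∈ W)) S , ∅ ⟩} [] leafAt)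
        λ { _ g (S , S∈) → g (S , vecs-complete S , S∈) })
      where
      leafAt : ∀ S {Δ} → Deriv Δ → [] ⊑ Δ →
               Ext Δ 1 {Member proper S} (λ _ → ⟨ ∅ ∪ Unhit (∅ ∪ (_∈ W)) S , ∅ ⟩)
      leafAt S d _ with member? proper S
      ... | no ¬m = relax z≤n (done d λ m → ⊥-elim (¬m m))
      ... | yes (c , c∉) = retarget (addNode d (leaf (D c) (D⊆φ c) λ (x , b) ℓ∈ →
              inj₂ (inj₂ (all x) , c , c∉ , subst (λ v → (x , v) ∈C D c) (sym (not-involutive b)) ℓ∈)))
            λ _ g _ → g tt

    -- A model of `ψ` that hits every deleted clause would satisfy the whole formula.
    rootOk : ∀ β → Ok proper [] W emptyˢ β
    rootOk β {α} m = decidable-stable (member? proper _) λ none →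
      unsat α (λ C∈ → Model.satisfies m C∈ (touch C∈)) λ c →
        [ (λ c∈ → ⊥-elim (∉⊥ c∈)) , (λ c∈ → let x , _ , h = hit⁻ {W} {α} c∈ in x , h) ]′
          (SubsetP.x∈p∪q⁻ emptyˢ (hit W α)
            (decidable-stable (c SubsetP.∈? (emptyˢ ⊔ hit W α)) λ c∉ → none (c , c∉)))

    proper-size : size proper ≤ 2 ^ p
    proper-size = ℕP.≤-trans (length-filter (member? proper) (vecs p)) (ℕP.≤-reflexive (length-vecs p))

    cost : ℕ
    cost = weight states (2 ^ p) * (length W * length W) +
           (length (allFin n) * (2 ^ p * 2 * (refCost * length W)) + 2 ^ p * 1)

    derivation : Ext [] cost {⊤} (λ _ → ⟨ ∅ , ∅ ∪ (_∈ W) ⟩)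
    derivation = subst (λ N → Ext [] N {⊤} (λ _ → ⟨ ∅ , ∅ ∪ (_∈ W) ⟩)) (ℕP.+-assoc (weight states (2 ^ p) * (length W * length W)) _ _)
      (leaves >>= λ d₁ _ g₁ →
       refuteAll (allFin n) t d₁ >>= λ d₂ m₂ g₂ →
       retarget (explore (2 ^ p) t proper proper-size ∅ ∅ ∅ (λ _ ()) d₂
         (λ s Z b r → g₂ (failGoal s Z b r)) (λ {S} S∈ → m₂ (g₁ (S , S∈))))
       λ _ g _ → weaken ((λ { (inj₁ ()) ; (inj₂ (inj₁ (() , _))) ; (inj₂ (inj₂ (() , _))) }) , id)
         -- The top bag is empty, so any assignment will do.
         (g (goal emptyˢ (replicate n false) (rootOk _))))

    cost-≤ : 1 ≤ n → cost ≤ coefficient K p * n ^ 2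
    cost-≤ 1≤n = begin
      cost
        ≤⟨ ℕP.+-mono-≤ (ℕP.*-monoʳ-≤ (weight states (2 ^ p)) (ℕP.*-mono-≤ W≤n W≤n))
            (ℕP.+-mono-≤ (ℕP.*-mono-≤ (ℕP.≤-reflexive |allFin|)
                (ℕP.*-monoʳ-≤ (2 ^ p * 2) (ℕP.*-monoʳ-≤ refCost W≤n)))
              -- The constant number of leaves is absorbed by `n * n`.
              (ℕP.*-monoʳ-≤ (2 ^ p) (ℕP.*-mono-≤ 1≤n 1≤n))) ⟩
      weight states (2 ^ p) * (n * n) + (n * (2 ^ p * 2 * (refCost * n)) + 2 ^ p * (n * n))
        ≡⟨ collect (weight states (2 ^ p)) (2 ^ p * 2) refCost (2 ^ p) n ⟩
      coefficient K p * n ^ 2 ∎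
      where
      open ℕP.≤-Reasoning
      |allFin| : length (allFin n) ≡ n
      |allFin| = length-tabulate id
      W≤n : length W ≤ n
      W≤n = subst (length W ≤_) |allFin| (unique-⊆-length (TD-unique t) (λ _ → ∈-allFin _))
      collect : ∀ w a b c n → w * (n * n) + (n * (a * (b * n)) + c * (n * n)) ≡ (w + a * b + c) * (n * (n * 1))
      collect = solve-∀

    refuted : 1 ≤ n → ∃[ s ] (s ≤ coefficient K p * n ^ 2 × RRRefutation φ s)
    refuted 1≤n with derivation
    ... | ext d _ size g with refutation d (g tt)
    ... | s , s≤ , R = s , ℕP.≤-trans s≤ (ℕP.≤-trans size (ℕP.≤-trans (ℕP.≤-reflexive (ℕP.+-identityʳ cost)) (cost-≤ 1≤n))) , R

-- A clause without literals touches no variable and escapes `Model`, so it is treated apart.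
trivialRefutation : ∀ {n} {φ : CNF n} {C} → C ∈ φ → (∀ ℓ → ¬ ℓ ∈C C) → ∃[ s ] (s ≤ 1 × RRRefutation φ s)
trivialRefutation {φ = φ} {C} C∈ none = refutation {V = ∅}
  (leaf C C∈ (λ ℓ ℓ∈ → ⊥-elim (none ℓ ℓ∈)) ∷ []) (at zero (id , id))
  where open Derivation φ

-- The sum makes the bound monotone in `p`, since fewer than `p` clauses may really be deleted; the
-- successor leaves room for the one-node refutation.
factor : ℕ → ℕ → ℕ
factor k zero    = suc (coefficient (suc k) 0)
factor k (suc p) = factor k p + coefficient (suc k) (suc p)

factor-pos : ∀ k p → 1 ≤ factor k p
factor-pos k zero    = s≤s z≤n
factor-pos k (suc p) = ℕP.≤-trans (factor-pos k p) (ℕP.m≤m+n _ _)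

coefficient≤factor : ∀ k {q p} → q ≤ p → coefficient (suc k) q ≤ factor k p
coefficient≤factor k {p = zero} z≤n = ℕP.n≤1+n _
coefficient≤factor k {q} {suc p} q≤ with ℕP.m≤n⇒m<n∨m≡n q≤
... | inj₁ (s≤s q≤p) = ℕP.≤-trans (coefficient≤factor k q≤p) (ℕP.m≤m+n _ _)
... | inj₂ refl      = ℕP.m≤n+m _ (factor k p)

theorem1 : Σ (ℕ → ℕ → ℕ) λ f →
    ∀ (n k p : ℕ) (φ : CNF n) → 1 ≤ n → Unsatisfiable φ → DeletionTW φ k p →
    ∃[ s ] (s ≤ f k p * n ^ 2 × RRRefutation φ s)
theorem1 = factor , λ n k p φ 1≤n unsat (D , |D|≤p , T) → bounded n k p φ 1≤n unsat D |D|≤p T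
  where
  bounded : ∀ n k p (φ : CNF n) → 1 ≤ n → Unsatisfiable φ → ∀ D → length D ≤ p →
            TreewidthAtMost (PrimalGraph (remove D φ)) k →
            ∃[ s ] (s ≤ factor k p * n ^ 2 × RRRefutation φ s)
  bounded n k p φ 1≤n unsat D |D|≤p T with Any.any? (λ C → ¬? (touches? (allFin n) C)) (remove D φ)
  ... | yes found = case find found of λ (C , C∈ , ¬touch) →
    let s , s≤ , R = trivialRefutation (ψ⊆φ C∈) (λ (x , b) ℓ∈ → ¬touch (x , ∈-allFin x , ∈C⇒occurs b ℓ∈)) in
    s , ℕP.≤-trans s≤ (ℕP.*-mono-≤ (factor-pos k p) (ℕP.*-mono-≤ 1≤n (ℕP.*-mono-≤ 1≤n ℕP.≤-refl))) , R
    where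
    ψ⊆φ : ∀ {C} → C ∈ remove D φ → C ∈ φ
    ψ⊆φ C∈ = proj₁ (∈-filter⁻ (λ C → ¬? (DecMembership._∈?_ clause-≟ C D)) C∈)
  ... | no none =
    let s , s≤ , R = refuted (λ c → proj₂ (∈-filter⁻ inφ? {xs = D} (∈-lookup {xs = D′} c)))
          tree all unsat′ touch 1≤n in
    s , ℕP.≤-trans s≤ (ℕP.*-monoˡ-≤ (n ^ 2)
          (coefficient≤factor k (ℕP.≤-trans (length-filter inφ? D) |D|≤p))) , R
    where
    _∈ᶜ?_ = DecMembership._∈?_ (clause-≟ {n})
    inφ? : Decidable (_∈ φ)
    inφ? C = C ∈ᶜ? φ
    notD? : Decidable (_∉ D)
    notD? C = ¬? (C ∈ᶜ? D)
    -- `D` may list clauses foreign to `φ`, which cannot label sinks.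
    D′ : List (Clause n)
    D′ = filter inφ? D
    ψ : CNF n
    ψ = remove D φ
    ψ⊆φ : ∀ {C} → C ∈ ψ → C ∈ φ
    ψ⊆φ C∈ = proj₁ (∈-filter⁻ notD? C∈)
    -- Bags of a decomposition of width `k` have up to `suc k` vertices.
    open Refutation φ ψ ψ⊆φ (suc k) (List.lookup D′)
    open Decomposition (PrimalGraph ψ) primal-sym (suc k)
    open FromTree ℕP.≤-refl T
    W = proj₁ fromTree
    tree : TD [] W
    tree = proj₁ (proj₂ fromTree)
    all : ∀ x → x ∈ W
    all = proj₂ (proj₂ fromTree)
    touch : ∀ {C} → C ∈ ψ → Touches W C
    touch {C} C∈ with touches? (allFin n) C
    ... | yes (x , _ , o) = x , all x , o
    ... | no ¬t = ⊥-elim (none (Any.map (λ { refl → ¬t }) C∈))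
    unsat′ : ∀ α → (∀ {C} → C ∈ ψ → Sat α C) → ¬ (∀ c → Sat α (List.lookup D′ c))
    unsat′ α satψ satD = unsat (lookup α , λ C C∈ → let x , x∈ = sat C C∈ in (x , lookup α x) , x∈ , refl)
      where
      sat : ∀ C → C ∈ φ → Sat α C
      sat C C∈ with C ∈ᶜ? D
      ... | no C∉   = satψ (∈-filter⁺ notD? C∈ C∉)
      ... | yes C∈D = subst (Sat α) (sym (AnyP.lookup-index C∈D′)) (satD (Any.index C∈D′))
        where
        C∈D′ : C ∈ D′
        C∈D′ = ∈-filter⁺ inφ? C∈D C∈
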